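{- For $d\ge 3$ let $\Omega_d$ be the set of finite simple graphs on the vertex set $[d]=\{1,\dots,d\}$, let $K_d$ be the complete graph on $[d]$, and for $G\in\Omega_d$ let $\varepsilon(G)$ be the number of edges (1-dimensional faces) of the edge polytope $\mathcal{P}_G$. Then: (a) If $3\le d\le 13$ and $G\in\Omega_d$ with $G\neq K_d$, then $\varepsilon(G)<\varepsilon(K_d)$. (b) If $G\in\Omega_{14}$ with $G\neq K_{14}$, then $\varepsilon(G)\le\varepsilon(K_{14})$. Moreover, $\varepsilon(G)=\varepsilon(K_{14})$ if and only if $G=K_{14}-K_{4,5}$ or $G=K_{14}-K_{5,5}$, i.e. if and only if the complement of $G$ (the graph on $[14]$ whose edges are the non-edges of $G$) is a complete bipartite graph $K_{4,5}$ together with $5$ isolated vertices, or a complete bipartite graph $K_{5,5}$ together with $4$ isolated vertices. (c) If $d\ge 15$, then there exists $G\in\Omega_d$ such that $\varepsilon(G)>\varepsilon(K_d)$.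
   Context: For $G\in\Omega_d$ with edge set $E(G)$ and $e=\{i,j\}\in E(G)$, set $\rho(e)=\mathbf{e}_i+\mathbf{e}_j\in\mathbb{R}^d$, where $\mathbf{e}_i$ is the $i$th unit coordinate vector. The edge polytope $\mathcal{P}_G$ is the convex hull of $\{\rho(e): e\in E(G)\}$ in $\mathbb{R}^d$. For a graph $H$ whose vertex set is contained in $[d]$, $K_d-H$ denotes the graph on $[d]$ with edge set $E(K_d)\setminus E(H)$; $K_{m,n}$ denotes the complete bipartite graph with parts of sizes $m$ and $n$. -}

module Defs where

open import Data.Nat using (ℕ; zero; suc)
open import Data.Bool using (Bool; true; false; not)
open import Data.Fin using (Fin; _<_; _≟_)
open import Data.Fin.Subset using (Subset; _∈_; _∉_; ∣_∣)
open import Data.Integer as ℤ using (ℤ)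
open import Data.List using (List; []; _∷_; concatMap; map)
open import Data.Fin.Base using ()
open import Data.List using (allFin)
open import Data.Product using (Σ; _×_; _,_)
open import Data.Sum using (_⊎_)
open import Data.Empty using (⊥-elim)
open import Relation.Nullary using (¬_; yes; no)
open import Relation.Nullary.Decidable using (⌊_⌋)
open import Relation.Binary.PropositionalEquality using (_≡_; refl; _≢_; sym)

record Graph (d : ℕ) : Set where
  field
    adj    : Fin d → Fin d → Bool
    adjSym : ∀ i j → adj i j ≡ adj j i
    irrefl : ∀ i → adj i i ≡ false
open Graph public

private
  ≟-sym : ∀ {d} (i j : Fin d) → not ⌊ i ≟ j ⌋ ≡ not ⌊ j ≟ i ⌋
  ≟-sym i j with i ≟ j | j ≟ i
  ... | yes _ | yes _ = refl
  ... | no _  | no _  = refl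
  ... | yes p | no q  = ⊥-elim (q (sym p))
  ... | no p  | yes q = ⊥-elim (p (sym q))

  ≟-irr : ∀ {d} (i : Fin d) → not ⌊ i ≟ i ⌋ ≡ false
  ≟-irr i with i ≟ i
  ... | yes _ = refl
  ... | no p  = ⊥-elim (p refl)

K : (d : ℕ) → Graph d
K d = record { adj = λ i j → not ⌊ i ≟ j ⌋ ; adjSym = ≟-sym ; irrefl = ≟-irr }

-- G is the complete graph on [d] (graphs compared via their edge sets).
IsComplete : ∀ {d} → Graph d → Set
IsComplete {d} G = ∀ (i j : Fin d) → i ≢ j → adj G i j ≡ true

IsEdge : ∀ {d} → Graph d → Fin d → Fin d → Set
IsEdge G i j = (i < j) × (adj G i j ≡ true)

-- Value of the linear functional w at rho({i,j}) = e_i + e_j.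
val : ∀ {d} → (Fin d → ℤ) → Fin d → Fin d → ℤ
val w i j = w i ℤ.+ w j

-- {rho({i,j}), rho({k,l})} spans a 1-dimensional face (edge) of the edge
-- polytope P_G: {i,j}, {k,l} are distinct edges of G (ordered
-- lexicographically so that each unordered pair is counted once) and there is
-- a linear functional w attaining its maximum over the vertices of P_G exactly
-- at rho({i,j}) and rho({k,l}).
IsPolytopeEdge : ∀ {d} → Graph d → Fin d → Fin d → Fin d → Fin d → Set
IsPolytopeEdge {d} G i j k l =
  IsEdge G i j × IsEdge G k l × ((i < k) ⊎ ((i ≡ k) × (j < l))) ×
  Σ (Fin d → ℤ) λ w →
    (val w i j ≡ val w k l) ×
    (∀ a b → IsEdge G a b → ¬ ((a ≡ i) × (b ≡ j)) → ¬ ((a ≡ k) × (b ≡ l)) →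
       val w a b ℤ.< val w i j)

data CountIn {A : Set} (P : A → Set) : List A → ℕ → Set where
  c-nil  : CountIn P [] 0
  c-yes  : ∀ {x xs n} → P x → CountIn P xs n → CountIn P (x ∷ xs) (suc n)
  c-no   : ∀ {x xs n} → ¬ P x → CountIn P xs n → CountIn P (x ∷ xs) n

Quad : ℕ → Set
Quad d = Fin d × Fin d × Fin d × Fin d

allQuads : (d : ℕ) → List (Quad d)
allQuads d = concatMap (λ i → concatMap (λ j → concatMap (λ k → map (λ l → (i , j , k , l))
               (allFin d)) (allFin d)) (allFin d)) (allFin d)

NumPolytopeEdges : ∀ {d} → Graph d → ℕ → Set
NumPolytopeEdges {d} G n =
  CountIn (λ { (i , j , k , l) → IsPolytopeEdge G i j k l }) (allQuads d) n

ComplementIsKpq : ∀ {d} → Graph d → ℕ → ℕ → Set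
ComplementIsKpq {d} G p q =
  Σ (Subset d) λ A → Σ (Subset d) λ B →
    (∣ A ∣ ≡ p) × (∣ B ∣ ≡ q) × (∀ i → i ∈ A → i ∉ B) ×
    (∀ i j → i ≢ j →
       (adj G i j ≡ false → ((i ∈ A) × (j ∈ B)) ⊎ ((i ∈ B) × (j ∈ A))) ×
       (((i ∈ A) × (j ∈ B)) ⊎ ((i ∈ B) × (j ∈ A)) → adj G i j ≡ false))

{-# OPTIONS --safe #-}
module Submission where

-- Let H be the complement of G. Two edges of G span an edge of P_G iff they
-- share a vertex, or they are disjoint and their four vertices carry no other
-- perfect matching in G; the latter happens once for every 4-set inducing C₄,
-- P₄ or P₃ + K₁ in H. Hence ε(G) - ε(K_d) = (paths P₃ in H) + (such 4-sets)
-- - (2d - 4) |E(H)|. Distribute the positive terms over the edges uv of H: half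
-- of each P₃ and of each P₃ + K₁ to each of its edges, a quarter of each C₄ to
-- each of its edges, a quarter of each P₄ to its middle edge and 3/8 to each end
-- edge. If p and q vertices are H-adjacent to u only and to v only, t to both
-- and s to neither, then uv receives at most
-- (p + q)/2 + t + pq/4 + (p + q)s/2, with p + q + t + s = d - 2. This is less
-- than 2d - 4 for d ≤ 13, and for d = 14 at most 24, attained only for t = 0 and
-- (p, q, s) = (3, 4, 5), (4, 3, 5), (4, 4, 4). If every edge of H attains it,
-- then H has no triangle and no induced P₄, so its components are complete
-- bipartite, and there is room for one only. For d ≥ 15 removing K₅₅ beats K_d.

open import Defs
open import Data.Nat as ℕ using (ℕ; zero; suc; _+_; _*_; _∸_; _≤_; _<_; z≤n; s≤s)
import Data.Nat.Properties as ℕ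
open import Data.Nat.ListAction using () renaming (sum to sumList)
open import Data.Nat.ListAction.Properties using (sum-++)
open import Data.Nat.Tactic.RingSolver using (solve-∀)
open import Data.Integer as ℤ using (ℤ; +<+) renaming (+_ to pos)
import Data.Integer.Properties as ℤ
open import Data.Integer.Tactic.RingSolver using () renaming (solve-∀ to ℤ-solve-∀)
open import Data.Bool using (Bool; true; false)
open import Data.Fin using (Fin; zero; suc; _≟_; _<?_) renaming (_<_ to _<ᶠ_)
import Data.Fin.Properties as Fin
open import Data.Fin.Subset as Subset using (Subset; _∈_; _∉_; ∣_∣)
open import Data.Fin.Subset.Properties using (∣⊥∣≡0; _∈?_; ∉⊥)
open import Data.List as List using (List; []; _∷_; _++_; map; concatMap; allFin)
open import Data.List.Properties using (map-++; map-∘; map-tabulate)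
open import Data.Vec using ([]; _∷_; lookup; tabulate)
open import Data.Vec.Properties using (lookup∘tabulate; []=⇒lookup; lookup⇒[]=)
open import Data.Product using (Σ; _×_; _,_; proj₁; proj₂; ∃₂)
open import Data.Sum using (_⊎_; inj₁; inj₂; swap)
open import Data.Empty using (⊥; ⊥-elim)
open import Function using (_∘_; id)
open import Relation.Nullary using (¬_; Dec; yes; no)
open import Relation.Nullary.Decidable using (⌊_⌋; map′; toWitness; ¬?; _×-dec_; _⊎-dec_; _→-dec_)
open import Relation.Binary.Definitions using (tri<; tri≈; tri>)
open import Relation.Binary.PropositionalEquality
import Algebra.Properties.Semiring.Sum ℕ.+-*-semiring as Sum

-- The four pairs joining {i,j} to {k,l} form a 4-cycle, and its two pairs of opposite sides are the
-- other matchings. Both fail exactly when H contains two consecutive sides; their common vertex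
-- then has no G-neighbour in the opposite edge, and weights 3 there, 1 on its partner, 2 on the
-- opposite edge and 0 elsewhere single out the two edges. Two, three or four sides in H give P₃ +
-- K₁, P₄ or C₄. The shares are chosen so that they multiply. One H-neighbour of u alone and one of
-- v alone complete uv to a C₄ or to a P₄ with middle edge uv; equal quarters make this pq/4
-- whatever lies between them. The ends of a P₄ then split 3/4, and 3/8 falls short of the 1/2 given
-- for P₃ + K₁ by 1/8. So the local bound is an identity whose deficit is counted by `#escapes`, and
-- equality excludes induced P₄. Each share involves four vertices only, so the redistribution
-- becomes an identity in six relations, decided by evaluation once both sides are symmetrised over
-- the 24 orderings.

-- Sums over Fin d

-- Opaque, so that unification may treat ∑ as injective.
opaque

  ∑ : ∀ {d} → (Fin d → ℕ) → ℕ
  ∑ = Sum.sum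

  ∑-nil : (f : Fin 0 → ℕ) → ∑ f ≡ 0
  ∑-nil f = refl

  ∑-suc : ∀ {d} (f : Fin (suc d) → ℕ) → ∑ f ≡ f zero + ∑ (f ∘ suc)
  ∑-suc f = refl

  ∑-cong : ∀ {d} {f g : Fin d → ℕ} → (∀ i → f i ≡ g i) → ∑ f ≡ ∑ g
  ∑-cong = Sum.sum-cong-≗

  ∑-+ : ∀ {d} (f g : Fin d → ℕ) → ∑ (λ i → f i + g i) ≡ ∑ f + ∑ g
  ∑-+ = Sum.∑-distrib-+

  ∑-comm : ∀ {d e} (f : Fin d → Fin e → ℕ) →
    ∑ (λ i → ∑ λ j → f i j) ≡ ∑ (λ j → ∑ λ i → f i j)
  ∑-comm = Sum.∑-comm

  ∑-*ˡ : ∀ {d} c (f : Fin d → ℕ) → ∑ (λ i → c * f i) ≡ c * ∑ f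
  ∑-*ˡ c f = sym (Sum.*-distribˡ-sum c f)

  ∑-*ʳ : ∀ {d} c (f : Fin d → ℕ) → ∑ (λ i → f i * c) ≡ ∑ f * c
  ∑-*ʳ c f = sym (Sum.*-distribʳ-sum c f)

  ∑-zero : ∀ {d} {f : Fin d → ℕ} → (∀ i → f i ≡ 0) → ∑ f ≡ 0
  ∑-zero {d} eq = trans (Sum.sum-cong-≗ eq) (Sum.sum-replicate-zero d)

  ∑-one : ∀ d → ∑ {d} (λ _ → 1) ≡ d
  ∑-one zero = refl
  ∑-one (suc d) = cong suc (∑-one d)

  ∑-mono : ∀ {d} {f g : Fin d → ℕ} → (∀ i → f i ≤ g i) → ∑ f ≤ ∑ g
  ∑-mono {zero} le = z≤n
  ∑-mono {suc d} le = ℕ.+-mono-≤ (le zero) (∑-mono (le ∘ suc))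

  ∑-mono-< : ∀ {d} {f g : Fin d → ℕ} → (∀ i → f i ≤ g i) → ∀ i → f i < g i → ∑ f < ∑ g
  ∑-mono-< le zero lt = ℕ.+-mono-<-≤ lt (∑-mono (le ∘ suc))
  ∑-mono-< le (suc i) lt = ℕ.+-mono-≤-< (le zero) (∑-mono-< (le ∘ suc) i lt)

  ∑-term : ∀ {d} (f : Fin d → ℕ) i → f i ≤ ∑ f
  ∑-term f zero = ℕ.m≤m+n _ _
  ∑-term f (suc i) = ℕ.≤-trans (∑-term (f ∘ suc) i) (ℕ.m≤n+m _ _)

  sumList-tabulate : ∀ {d} (f : Fin d → ℕ) → sumList (List.tabulate f) ≡ ∑ f
  sumList-tabulate {zero} f = refl
  sumList-tabulate {suc d} f = cong (f zero +_) (sumList-tabulate (f ∘ suc))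

∑-single : ∀ {d} (f : Fin d → ℕ) i → (∀ k → k ≢ i → f k ≡ 0) → ∑ f ≡ f i
∑-single f zero zeros = trans (∑-suc f)
  (trans (cong (f zero +_) (∑-zero λ k → zeros (suc k) λ ())) (ℕ.+-identityʳ _))
∑-single f (suc i) zeros = trans (∑-suc f)
  (trans (cong (_+ ∑ (f ∘ suc)) (zeros zero λ ()))
    (∑-single (f ∘ suc) i λ k k≢i → zeros (suc k) (k≢i ∘ Fin.suc-injective)))

∑² : (d : ℕ) → (Fin d → Fin d → ℕ) → ℕ
∑² d f = ∑ λ i → ∑ λ j → f i j

∑³ : (d : ℕ) → (Fin d → Fin d → Fin d → ℕ) → ℕ
∑³ d f = ∑ λ i → ∑² d (f i)

∑⁴ : (d : ℕ) → (Fin d → Fin d → Fin d → Fin d → ℕ) → ℕ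
∑⁴ d f = ∑ λ i → ∑³ d (f i)

module _ {d : ℕ} where

  ∑²-cong : ∀ {f g} → (∀ i j → f i j ≡ g i j) → ∑² d f ≡ ∑² d g
  ∑²-cong eq = ∑-cong λ i → ∑-cong (eq i)

  ∑³-cong : ∀ {f g} → (∀ i j k → f i j k ≡ g i j k) → ∑³ d f ≡ ∑³ d g
  ∑³-cong eq = ∑-cong λ i → ∑²-cong (eq i)

  ∑⁴-cong : ∀ {f g} → (∀ i j k l → f i j k l ≡ g i j k l) → ∑⁴ d f ≡ ∑⁴ d g
  ∑⁴-cong eq = ∑-cong λ i → ∑³-cong (eq i)

  ∑²-+ : ∀ f g → ∑² d (λ i j → f i j + g i j) ≡ ∑² d f + ∑² d g
  ∑²-+ f g = trans (∑-cong λ i → ∑-+ (f i) (g i)) (∑-+ _ _)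

  ∑³-+ : ∀ f g → ∑³ d (λ i j k → f i j k + g i j k) ≡ ∑³ d f + ∑³ d g
  ∑³-+ f g = trans (∑-cong λ i → ∑²-+ (f i) (g i)) (∑-+ _ _)

  ∑⁴-+ : ∀ f g → ∑⁴ d (λ i j k l → f i j k l + g i j k l) ≡ ∑⁴ d f + ∑⁴ d g
  ∑⁴-+ f g = trans (∑-cong λ i → ∑³-+ (f i) (g i)) (∑-+ _ _)

  ∑²-* : ∀ c f → ∑² d (λ i j → c * f i j) ≡ c * ∑² d f
  ∑²-* c f = trans (∑-cong λ i → ∑-*ˡ c (f i)) (∑-*ˡ c _)

  ∑³-* : ∀ c f → ∑³ d (λ i j k → c * f i j k) ≡ c * ∑³ d f
  ∑³-* c f = trans (∑-cong λ i → ∑²-* c (f i)) (∑-*ˡ c _)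

  ∑⁴-* : ∀ c f → ∑⁴ d (λ i j k l → c * f i j k l) ≡ c * ∑⁴ d f
  ∑⁴-* c f = trans (∑-cong λ i → ∑³-* c (f i)) (∑-*ˡ c _)

  ∑²-product : ∀ (f g : Fin d → ℕ) → ∑² d (λ i j → f i * g j) ≡ ∑ f * ∑ g
  ∑²-product f g = trans (∑-cong λ i → ∑-*ˡ (f i) g) (∑-*ʳ (∑ g) f)

  ∑³-swap₁₂ : ∀ f → ∑³ d f ≡ ∑³ d (λ i j k → f j i k)
  ∑³-swap₁₂ f = ∑-comm (λ i j → ∑ λ k → f i j k)

  ∑³-swap₂₃ : ∀ f → ∑³ d f ≡ ∑³ d (λ i j k → f i k j)
  ∑³-swap₂₃ f = ∑-cong λ i → ∑-comm (f i)

  ∑⁴-swap₁₂ : ∀ f → ∑⁴ d f ≡ ∑⁴ d (λ i j k l → f j i k l)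
  ∑⁴-swap₁₂ f = ∑-comm (λ i j → ∑² d (f i j))

  ∑⁴-swap₂₃ : ∀ f → ∑⁴ d f ≡ ∑⁴ d (λ i j k l → f i k j l)
  ∑⁴-swap₂₃ f = ∑-cong λ i → ∑³-swap₁₂ (f i)

  ∑⁴-swap₃₄ : ∀ f → ∑⁴ d f ≡ ∑⁴ d (λ i j k l → f i j l k)
  ∑⁴-swap₃₄ f = ∑-cong λ i → ∑³-swap₂₃ (f i)

  ∑⁴-swap₁₃ : ∀ f → ∑⁴ d f ≡ ∑⁴ d (λ i j k l → f k j i l)
  ∑⁴-swap₁₃ f = trans (∑⁴-swap₁₂ f) (trans (∑⁴-swap₂₃ _) (∑⁴-swap₁₂ _))

  ∑⁴-swap₂₄ : ∀ f → ∑⁴ d f ≡ ∑⁴ d (λ i j k l → f i l k j)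
  ∑⁴-swap₂₄ f = trans (∑⁴-swap₂₃ f) (trans (∑⁴-swap₃₄ _) (∑⁴-swap₂₃ _))

  ∑⁴-swap₁₄ : ∀ f → ∑⁴ d f ≡ ∑⁴ d (λ i j k l → f l j k i)
  ∑⁴-swap₁₄ f = trans (∑⁴-swap₁₂ f) (trans (∑⁴-swap₂₄ _) (∑⁴-swap₁₂ _))

  ∑⁴-swap-pairs : ∀ f → ∑⁴ d f ≡ ∑⁴ d (λ i j k l → f k l i j)
  ∑⁴-swap-pairs f = trans (∑⁴-swap₁₃ f) (∑⁴-swap₂₄ _)

-- The 24 permutations are generated as products of coset representatives for S₂ ≤ S₃ ≤ S₄.
module _ {A : Set} where

  sym₂ sym₃ sym₄ symmetrise : (A → A → A → A → ℕ) → A → A → A → A → ℕ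
  sym₂ f i j k l = f i j k l + f j i k l
  sym₃ f i j k l = f i j k l + (f k j i l + f i k j l)
  sym₄ f i j k l = f i j k l + (f l j k i + (f i l k j + f i j l k))
  symmetrise f = sym₄ (sym₃ (sym₂ f))

-- Renaming the summation variables does not change a full sum, so each of the 24 orderings
-- contributes the same. Two functions with equal symmetrisations therefore have equal sums even
-- where they differ pointwise.
∑⁴-symmetrise : ∀ d f → ∑⁴ d (symmetrise f) ≡ 24 * ∑⁴ d f
∑⁴-symmetrise d f = begin
  ∑⁴ d (sym₄ f₃)      ≡⟨ four f₃ ⟩
  4 * ∑⁴ d (sym₃ f₂)  ≡⟨ cong (4 *_) (three f₂) ⟩
  4 * (3 * ∑⁴ d f₂)   ≡⟨ cong (λ z → 4 * (3 * z)) (two f) ⟩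
  4 * (3 * (2 * ∑⁴ d f)) ≡⟨ arith (∑⁴ d f) ⟩
  24 * ∑⁴ d f ∎
  where
  open ≡-Reasoning
  f₂ = sym₂ f
  f₃ = sym₃ f₂
  arith : ∀ x → 4 * (3 * (2 * x)) ≡ 24 * x
  arith = solve-∀
  twice : ∀ x → x + x ≡ 2 * x
  twice = solve-∀
  thrice : ∀ x → x + (x + x) ≡ 3 * x
  thrice = solve-∀
  fourfold : ∀ x → x + (x + (x + x)) ≡ 4 * x
  fourfold = solve-∀
  two : ∀ g → ∑⁴ d (sym₂ g) ≡ 2 * ∑⁴ d g
  two g = trans (∑⁴-+ _ _)
    (trans (cong (∑⁴ d g +_) (sym (∑⁴-swap₁₂ g))) (twice (∑⁴ d g)))
  three : ∀ g → ∑⁴ d (sym₃ g) ≡ 3 * ∑⁴ d g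
  three g = trans (∑⁴-+ _ _) (trans (cong (∑⁴ d g +_) (trans (∑⁴-+ _ _)
    (cong₂ _+_ (sym (∑⁴-swap₁₃ g)) (sym (∑⁴-swap₂₃ g))))) (thrice (∑⁴ d g)))
  four : ∀ g → ∑⁴ d (sym₄ g) ≡ 4 * ∑⁴ d g
  four g = trans (∑⁴-+ _ _) (trans (cong (∑⁴ d g +_) (trans (∑⁴-+ _ _)
    (cong₂ _+_ (sym (∑⁴-swap₁₄ g)) (trans (∑⁴-+ _ _)
      (cong₂ _+_ (sym (∑⁴-swap₂₄ g)) (sym (∑⁴-swap₃₄ g))))))) (fourfold (∑⁴ d g)))

-- Counting over the list of quadruples

sumList-concatMap : ∀ {A B : Set} (f : B → ℕ) (g : A → List B) xs →
  sumList (map f (concatMap g xs)) ≡ sumList (map (λ x → sumList (map f (g x))) xs)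
sumList-concatMap f g [] = refl
sumList-concatMap f g (x ∷ xs) = begin
  sumList (map f (g x ++ concatMap g xs))                    ≡⟨ cong sumList (map-++ f (g x) _) ⟩
  sumList (map f (g x) ++ map f (concatMap g xs))            ≡⟨ sum-++ (map f (g x)) _ ⟩
  sumList (map f (g x)) + sumList (map f (concatMap g xs))   ≡⟨ cong (_ +_) (sumList-concatMap f g xs) ⟩
  sumList (map (λ x → sumList (map f (g x))) (x ∷ xs))       ∎
  where open ≡-Reasoning

sumList-allFin : ∀ {d} (f : Fin d → ℕ) → sumList (map f (allFin d)) ≡ ∑ f
sumList-allFin f = trans (cong sumList (map-tabulate id f)) (sumList-tabulate f)

sumList-allQuads : ∀ d (f : Quad d → ℕ) →
  sumList (map f (allQuads d)) ≡ ∑⁴ d (λ i j k l → f (i , j , k , l))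
sumList-allQuads d f =
  trans (step λ i → concatMap (λ j → concatMap (λ k → map (λ l → i , j , k , l)
    (allFin d)) (allFin d)) (allFin d)) (∑-cong λ i →
  trans (step λ j → concatMap (λ k → map (λ l → i , j , k , l) (allFin d)) (allFin d)) (∑-cong λ j →
  trans (step λ k → map (λ l → i , j , k , l) (allFin d)) (∑-cong λ k →
  trans (cong sumList (sym (map-∘ (allFin d)))) (sumList-allFin (λ l → f (i , j , k , l))))))
  where
  step : (g : Fin d → List (Quad d)) →
    sumList (map f (concatMap g (allFin d))) ≡ ∑ λ i → sumList (map f (g i))
  step g = trans (sumList-concatMap f g (allFin d)) (sumList-allFin (λ i → sumList (map f (g i))))

-- The property to be counted quantifies over all integer functionals, so its truth is not computed
-- but proved, case by case, along with the value of a numerical indicator.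
Indicates : Set → ℕ → Set
Indicates P n = (P × n ≡ 1) ⊎ (¬ P × n ≡ 0)

module _ {A : Set} {P : A → Set} {χ : A → ℕ} (ind : ∀ x → Indicates (P x) (χ x)) where

  countIn-unique : ∀ {xs n} → CountIn P xs n → n ≡ sumList (map χ xs)
  countIn-unique c-nil = refl
  countIn-unique (c-yes {x} px c) with ind x
  ... | inj₁ (_ , eq) rewrite eq = cong suc (countIn-unique c)
  ... | inj₂ (¬px , _) = ⊥-elim (¬px px)
  countIn-unique (c-no {x} ¬px c) with ind x
  ... | inj₁ (px , _) = ⊥-elim (¬px px)
  ... | inj₂ (_ , eq) rewrite eq = countIn-unique c

  countIn-exists : ∀ xs → CountIn P xs (sumList (map χ xs))
  countIn-exists [] = c-nil
  countIn-exists (x ∷ xs) with ind x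
  ... | inj₁ (px , eq) rewrite eq = c-yes px (countIn-exists xs)
  ... | inj₂ (¬px , eq) rewrite eq = c-no ¬px (countIn-exists xs)

-- Position of a pair of vertices: equal, joined in G, or joined in the complement.
data Rel : Set where
  same edge non : Rel

isSame isEdge isNon distinct : Rel → ℕ
isSame same = 1
isSame edge = 0
isSame non  = 0
isEdge same = 0
isEdge edge = 1
isEdge non  = 0
isNon same = 0
isNon edge = 0
isNon non  = 1
distinct same = 0
distinct edge = 1
distinct non  = 1

opaque

  rel : ∀ {d} → Graph d → Fin d → Fin d → Rel
  rel G i j with i ≟ j | adj G i j
  ... | yes _ | _     = same
  ... | no _  | true  = edge
  ... | no _  | false = non

module _ {d} (G : Graph d) where

  opaque
    unfolding rel

    rel-refl : ∀ i → rel G i i ≡ same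
    rel-refl i with i ≟ i | adj G i i
    ... | yes _ | _ = refl
    ... | no i≢i | _ = ⊥-elim (i≢i refl)

    rel-edge : ∀ {i j} → adj G i j ≡ true → rel G i j ≡ edge
    rel-edge {i} {j} a with i ≟ j | adj G i j in eq
    ... | no _ | true = refl
    ... | yes refl | true with () ← trans (sym eq) (irrefl G i)

    rel-non : ∀ {i j} → i ≢ j → adj G i j ≡ false → rel G i j ≡ non
    rel-non {i} {j} i≢j a with i ≟ j | adj G i j
    ... | no _ | false = refl
    ... | yes i≡j | _ = ⊥-elim (i≢j i≡j)

    rel-same⁻¹ : ∀ {i j} → rel G i j ≡ same → i ≡ j
    rel-same⁻¹ {i} {j} eq with i ≟ j | adj G i j
    ... | yes i≡j | _ = i≡j
    rel-same⁻¹ {i} {j} () | no _ | true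
    rel-same⁻¹ {i} {j} () | no _ | false

    rel-edge⁻¹ : ∀ {i j} → rel G i j ≡ edge → adj G i j ≡ true
    rel-edge⁻¹ {i} {j} eq with i ≟ j | adj G i j
    ... | no _ | true = refl

    rel-non⁻¹ : ∀ {i j} → rel G i j ≡ non → adj G i j ≡ false
    rel-non⁻¹ {i} {j} eq with i ≟ j | adj G i j
    ... | no _ | false = refl

    rel-sym : ∀ i j → rel G i j ≡ rel G j i
    rel-sym i j with i ≟ j | j ≟ i | adj G i j | adj G j i | adjSym G i j
    ... | yes _   | yes _   | _     | _     | _    = refl
    ... | no _    | no _    | true  | true  | _    = refl
    ... | no _    | no _    | false | false | _    = refl
    ... | yes i≡j | no j≢i  | _     | _     | _    = ⊥-elim (j≢i (sym i≡j))
    ... | no i≢j  | yes j≡i | _     | _     | _    = ⊥-elim (i≢j (sym j≡i))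

  rel-≢ : ∀ {i j r} → rel G i j ≡ r → r ≢ same → i ≢ j
  rel-≢ {i} eq r≢ refl = r≢ (trans (sym eq) (rel-refl i))

-- Edges of the edge polytope

SamePair : ∀ {d} → Fin d → Fin d → Fin d → Fin d → Set
SamePair a b i j = ((a ≡ i) × (b ≡ j)) ⊎ ((a ≡ j) × (b ≡ i))

-- The last component of IsPolytopeEdge, freed from the ordering of the endpoints.
Exposed : ∀ {d} → Graph d → Fin d → Fin d → Fin d → Fin d → Set
Exposed {d} G i j k l = Σ (Fin d → ℤ) λ w →
  (val w i j ≡ val w k l) ×
  (∀ a b → adj G a b ≡ true → ¬ SamePair a b i j → ¬ SamePair a b k l → val w a b ℤ.< val w i j)

module _ {d} (G : Graph d) where

  exposed⇒polytopeEdge : ∀ {i j k l} → IsEdge G i j → IsEdge G k l →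
    (i <ᶠ k) ⊎ ((i ≡ k) × (j <ᶠ l)) → Exposed G i j k l → IsPolytopeEdge G i j k l
  exposed⇒polytopeEdge {i} {j} {k} {l} ij kl lex (w , eq , lt) = ij , kl , lex , w , eq , below
    where
    ordered : ∀ {a b x y : Fin d} → a <ᶠ b → x <ᶠ y → ¬ ((a ≡ x) × (b ≡ y)) → ¬ SamePair a b x y
    ordered a<b x<y ¬p (inj₁ p) = ¬p p
    ordered a<b x<y ¬p (inj₂ (refl , refl)) = Fin.<-asym a<b x<y
    below : ∀ a b → IsEdge G a b → ¬ ((a ≡ i) × (b ≡ j)) → ¬ ((a ≡ k) × (b ≡ l)) →
            val w a b ℤ.< val w i j
    below a b (a<b , ab) ¬ij ¬kl =
      lt a b ab (ordered a<b (proj₁ ij) ¬ij) (ordered a<b (proj₁ kl) ¬kl)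

  polytopeEdge⇒exposed : ∀ {i j k l} → IsPolytopeEdge G i j k l → Exposed G i j k l
  polytopeEdge⇒exposed {i} {j} {k} {l} (ij , kl , lex , w , eq , lt) = w , eq , below
    where
    below : ∀ a b → adj G a b ≡ true → ¬ SamePair a b i j → ¬ SamePair a b k l → val w a b ℤ.< val w i j
    below a b ab ¬ij ¬kl with Fin.<-cmp a b
    ... | tri< a<b _ _ = lt a b (a<b , ab) (¬ij ∘ inj₁) (¬kl ∘ inj₁)
    ... | tri≈ _ refl _ with () ← trans (sym ab) (irrefl G a)
    ... | tri> _ _ b<a = subst (ℤ._< val w i j) (ℤ.+-comm (w b) (w a))
      (lt b a (b<a , trans (adjSym G b a) ab)
        (λ (p , q) → ¬ij (inj₂ (q , p))) (λ (p , q) → ¬kl (inj₂ (q , p))))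

  exposed-flip₁ : ∀ {i j k l} → Exposed G i j k l → Exposed G j i k l
  exposed-flip₁ {i} {j} (w , eq , lt) = w , trans (ℤ.+-comm (w j) (w i)) eq ,
    λ a b ab ¬ji ¬kl → subst (val w a b ℤ.<_) (ℤ.+-comm (w i) (w j))
      (lt a b ab (λ { (inj₁ p) → ¬ji (inj₂ p) ; (inj₂ p) → ¬ji (inj₁ p) }) ¬kl)

  exposed-pairs : ∀ {i j k l} → Exposed G i j k l → Exposed G k l i j
  exposed-pairs (w , eq , lt) = w , sym eq ,
    λ a b ab ¬kl ¬ij → subst (val w a b ℤ.<_) eq (lt a b ab ¬ij ¬kl)

  exposed-flip₂ : ∀ {i j k l} → Exposed G i j k l → Exposed G i j l k
  exposed-flip₂ = exposed-pairs ∘ exposed-flip₁ ∘ exposed-pairs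

  private
    data View₃ (a b c x : Fin d) : Set where
      is-c  : x ≡ c → View₃ a b c x
      is-a  : x ≡ a → View₃ a b c x
      is-b  : x ≡ b → View₃ a b c x
      other : View₃ a b c x

    view₃ : ∀ a b c x → View₃ a b c x
    view₃ a b c x with x ≟ c | x ≟ a | x ≟ b
    ... | yes p | _ | _ = is-c p
    ... | no _ | yes p | _ = is-a p
    ... | no _ | no _ | yes p = is-b p
    ... | no _ | no _ | no _ = other

  -- The functional is 2 at `c`, 1 at `a` and `b`, and 0 elsewhere: an edge of value 3 or more must
  -- join `c` to `a` or `b`.
  exposed-path : ∀ {a b c} → a ≢ c → b ≢ c → Exposed G a c c b
  exposed-path {a} {b} {c} a≢c b≢c = (λ x → pos (w x)) , eq , below
    where
    weight : ∀ {x} → View₃ a b c x → ℕ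
    weight (is-c _) = 2
    weight (is-a _) = 1
    weight (is-b _) = 1
    weight other    = 0
    w : Fin d → ℕ
    w x = weight (view₃ a b c x)
    wc : w c ≡ 2
    wc with c ≟ c
    ... | yes _ = refl
    ... | no p = ⊥-elim (p refl)
    wa : w a ≡ 1
    wa with a ≟ c | a ≟ a
    ... | yes p | _ = ⊥-elim (a≢c p)
    ... | no _ | yes _ = refl
    ... | no _ | no p = ⊥-elim (p refl)
    wb : w b ≡ 1
    wb with b ≟ c | b ≟ a | b ≟ b
    ... | yes p | _ | _ = ⊥-elim (b≢c p)
    ... | no _ | yes _ | _ = refl
    ... | no _ | no _ | yes _ = refl
    ... | no _ | no _ | no p = ⊥-elim (p refl)
    eq : pos (w a + w c) ≡ pos (w c + w b)
    eq rewrite wa | wb | wc = refl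
    small : ∀ x y (vx : View₃ a b c x) (vy : View₃ a b c y) → adj G x y ≡ true →
            ¬ SamePair x y a c → ¬ SamePair x y c b → weight vx + weight vy < 3
    small x y (is-c refl) (is-c refl) xy _ _ with () ← trans (sym xy) (irrefl G c)
    small x y (is-c p) (is-a q) xy ¬ac ¬cb = ⊥-elim (¬ac (inj₂ (p , q)))
    small x y (is-c p) (is-b q) xy ¬ac ¬cb = ⊥-elim (¬cb (inj₁ (p , q)))
    small x y (is-a p) (is-c q) xy ¬ac ¬cb = ⊥-elim (¬ac (inj₁ (p , q)))
    small x y (is-b p) (is-c q) xy ¬ac ¬cb = ⊥-elim (¬cb (inj₂ (p , q)))
    small x y (is-c _) other    _ _ _ = s≤s (s≤s (s≤s z≤n))
    small x y (is-a _) (is-a _) _ _ _ = s≤s (s≤s (s≤s z≤n))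
    small x y (is-a _) (is-b _) _ _ _ = s≤s (s≤s (s≤s z≤n))
    small x y (is-a _) other    _ _ _ = s≤s (s≤s z≤n)
    small x y (is-b _) (is-a _) _ _ _ = s≤s (s≤s (s≤s z≤n))
    small x y (is-b _) (is-b _) _ _ _ = s≤s (s≤s (s≤s z≤n))
    small x y (is-b _) other    _ _ _ = s≤s (s≤s z≤n)
    small x y other    (is-c _) _ _ _ = s≤s (s≤s (s≤s z≤n))
    small x y other    (is-a _) _ _ _ = s≤s (s≤s z≤n)
    small x y other    (is-b _) _ _ _ = s≤s (s≤s z≤n)
    small x y other    other    _ _ _ = s≤s z≤n
    below : ∀ x y → adj G x y ≡ true → ¬ SamePair x y a c → ¬ SamePair x y c b →
            pos (w x + w y) ℤ.< pos (w a + w c)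
    below x y xy ¬ac ¬cb = subst (λ z → pos (w x + w y) ℤ.< pos z) (sym (cong₂ _+_ wa wc))
      (+<+ (small x y (view₃ a b c x) (view₃ a b c y) xy ¬ac ¬cb))

  private
    data View₄ (i j k l x : Fin d) : Set where
      is-i   : x ≡ i → View₄ i j k l x
      is-j   : x ≡ j → View₄ i j k l x
      is-k   : x ≡ k → View₄ i j k l x
      is-l   : x ≡ l → View₄ i j k l x
      other₄ : View₄ i j k l x

    view₄ : ∀ i j k l x → View₄ i j k l x
    view₄ i j k l x with x ≟ i | x ≟ j | x ≟ k | x ≟ l
    ... | yes p | _ | _ | _ = is-i p
    ... | no _ | yes p | _ | _ = is-j p
    ... | no _ | no _ | yes p | _ = is-k p
    ... | no _ | no _ | no _ | yes p = is-l p
    ... | no _ | no _ | no _ | no _ = other₄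

  -- The functional is 3 at `i`, 1 at `j`, 2 at `k` and `l`, and 0 elsewhere. Besides the two given
  -- edges only {i,k} and {i,l} would reach the value 4, and these are missing from `G`.
  exposed-disjoint : ∀ {i j k l} → j ≢ i → k ≢ i → k ≢ j → l ≢ i → l ≢ j →
    adj G i k ≡ false → adj G i l ≡ false → Exposed G i j k l
  exposed-disjoint {i} {j} {k} {l} j≢i k≢i k≢j l≢i l≢j ik il = (λ x → pos (w x)) , eq , below
    where
    weight : ∀ {x} → View₄ i j k l x → ℕ
    weight (is-i _) = 3
    weight (is-j _) = 1
    weight (is-k _) = 2
    weight (is-l _) = 2
    weight other₄   = 0
    w : Fin d → ℕ
    w x = weight (view₄ i j k l x)
    wi : w i ≡ 3
    wi with i ≟ i
    ... | yes _ = refl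
    ... | no p = ⊥-elim (p refl)
    wj : w j ≡ 1
    wj with j ≟ i | j ≟ j
    ... | yes p | _ = ⊥-elim (j≢i p)
    ... | no _ | yes _ = refl
    ... | no _ | no p = ⊥-elim (p refl)
    wk : w k ≡ 2
    wk with k ≟ i | k ≟ j | k ≟ k
    ... | yes p | _ | _ = ⊥-elim (k≢i p)
    ... | no _ | yes p | _ = ⊥-elim (k≢j p)
    ... | no _ | no _ | yes _ = refl
    ... | no _ | no _ | no p = ⊥-elim (p refl)
    wl : w l ≡ 2
    wl with l ≟ i | l ≟ j | l ≟ k | l ≟ l
    ... | yes p | _ | _ | _ = ⊥-elim (l≢i p)
    ... | no _ | yes p | _ | _ = ⊥-elim (l≢j p)
    ... | no _ | no _ | yes _ | _ = refl
    ... | no _ | no _ | no _ | yes _ = refl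
    ... | no _ | no _ | no _ | no p = ⊥-elim (p refl)
    eq : pos (w i + w j) ≡ pos (w k + w l)
    eq rewrite wi | wj | wk | wl = refl
    absurd : ∀ {A : Set} {x y x′ y′} → adj G x y ≡ true → x ≡ x′ → y ≡ y′ → adj G x′ y′ ≡ false → A
    absurd xy refl refl f with () ← trans (sym xy) f
    flip : ∀ {x y} → adj G x y ≡ false → adj G y x ≡ false
    flip {x} {y} f = trans (adjSym G y x) f
    small : ∀ x y (vx : View₄ i j k l x) (vy : View₄ i j k l y) → adj G x y ≡ true →
            ¬ SamePair x y i j → ¬ SamePair x y k l → weight vx + weight vy < 4
    small x y (is-i p) (is-i q) xy _ _ = absurd xy p q (irrefl G i)
    small x y (is-i p) (is-j q) _ ¬ij _ = ⊥-elim (¬ij (inj₁ (p , q)))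
    small x y (is-i p) (is-k q) xy _ _ = absurd xy p q ik
    small x y (is-i p) (is-l q) xy _ _ = absurd xy p q il
    small x y (is-i _) other₄ _ _ _ = s≤s (s≤s (s≤s (s≤s z≤n)))
    small x y (is-j p) (is-i q) _ ¬ij _ = ⊥-elim (¬ij (inj₂ (p , q)))
    small x y (is-j _) (is-j _) _ _ _ = s≤s (s≤s (s≤s z≤n))
    small x y (is-j _) (is-k _) _ _ _ = s≤s (s≤s (s≤s (s≤s z≤n)))
    small x y (is-j _) (is-l _) _ _ _ = s≤s (s≤s (s≤s (s≤s z≤n)))
    small x y (is-j _) other₄ _ _ _ = s≤s (s≤s z≤n)
    small x y (is-k p) (is-i q) xy _ _ = absurd xy p q (flip ik)
    small x y (is-k _) (is-j _) _ _ _ = s≤s (s≤s (s≤s (s≤s z≤n)))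
    small x y (is-k p) (is-k q) xy _ _ = absurd xy p q (irrefl G k)
    small x y (is-k p) (is-l q) _ _ ¬kl = ⊥-elim (¬kl (inj₁ (p , q)))
    small x y (is-k _) other₄ _ _ _ = s≤s (s≤s (s≤s z≤n))
    small x y (is-l p) (is-i q) xy _ _ = absurd xy p q (flip il)
    small x y (is-l _) (is-j _) _ _ _ = s≤s (s≤s (s≤s (s≤s z≤n)))
    small x y (is-l p) (is-k q) _ _ ¬kl = ⊥-elim (¬kl (inj₂ (p , q)))
    small x y (is-l p) (is-l q) xy _ _ = absurd xy p q (irrefl G l)
    small x y (is-l _) other₄ _ _ _ = s≤s (s≤s (s≤s z≤n))
    small x y other₄ (is-i _) _ _ _ = s≤s (s≤s (s≤s (s≤s z≤n)))
    small x y other₄ (is-j _) _ _ _ = s≤s (s≤s z≤n)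
    small x y other₄ (is-k _) _ _ _ = s≤s (s≤s (s≤s z≤n))
    small x y other₄ (is-l _) _ _ _ = s≤s (s≤s (s≤s z≤n))
    small x y other₄ other₄ _ _ _ = s≤s z≤n
    below : ∀ x y → adj G x y ≡ true → ¬ SamePair x y i j → ¬ SamePair x y k l →
            pos (w x + w y) ℤ.< pos (w i + w j)
    below x y xy ¬ij ¬kl = subst (λ z → pos (w x + w y) ℤ.< pos z) (sym (cong₂ _+_ wi wj))
      (+<+ (small x y (view₄ i j k l x) (view₄ i j k l y) xy ¬ij ¬kl))

  -- ρ{i,k} + ρ{j,l} = ρ{i,j} + ρ{k,l}, so a functional cannot single out one of the two pairs.
  ¬exposed-4-cycle : ∀ {i j k l} → i ≢ k → i ≢ l → j ≢ k → j ≢ l →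
    adj G i k ≡ true → adj G j l ≡ true → ¬ Exposed G i j k l
  ¬exposed-4-cycle {i} {j} {k} {l} i≢k i≢l j≢k j≢l ik jl (w , eq , lt) =
    ℤ.<-irrefl exchange (ℤ.+-mono-< ik<ij jl<kl)
    where
    ik<ij : val w i k ℤ.< val w i j
    ik<ij = lt i k ik
      (λ { (inj₁ (_ , q)) → j≢k (sym q) ; (inj₂ (_ , q)) → i≢k (sym q) })
      (λ { (inj₁ (q , _)) → i≢k q ; (inj₂ (q , _)) → i≢l q })
    jl<kl : val w j l ℤ.< val w k l
    jl<kl = subst (val w j l ℤ.<_) eq (lt j l jl
      (λ { (inj₁ (_ , q)) → j≢l (sym q) ; (inj₂ (_ , q)) → i≢l (sym q) })
      (λ { (inj₁ (q , _)) → j≢k q ; (inj₂ (q , _)) → j≢l q }))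
    exchange : val w i k ℤ.+ val w j l ≡ val w i j ℤ.+ val w k l
    exchange = solve (w i) (w j) (w k) (w l)
      where
      solve : ∀ a b c e → (a ℤ.+ c) ℤ.+ (b ℤ.+ e) ≡ (a ℤ.+ b) ℤ.+ (c ℤ.+ e)
      solve = ℤ-solve-∀

-- The number of polytope edges as a sum of indicators

Rel⁶→ℕ : Set
Rel⁶→ℕ = Rel → Rel → Rel → Rel → Rel → Rel → ℕ

-- Indicators, for edges {i,j} and {k,l}: exactly one common vertex (shared), and
-- disjoint with no second perfect matching on i, j, k, l (lone).
shared lone score : Rel⁶→ℕ
shared ij ik il jk jl kl = isEdge ij * isEdge kl *
  (isSame ik * distinct jl + isSame il * distinct jk + isSame jk * distinct il + isSame jl * distinct ik)
lone ij ik il jk jl kl = isEdge ij * isEdge kl *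
  (distinct ik * distinct il * distinct jk * distinct jl) *
  ((1 ∸ isEdge ik * isEdge jl) * (1 ∸ isEdge il * isEdge jk))
score ij ik il jk jl kl = shared ij ik il jk jl kl + lone ij ik il jk jl kl

onQuad : ∀ {d} → Rel⁶→ℕ → Graph d → Fin d → Fin d → Fin d → Fin d → ℕ
onQuad φ G i j k l = φ (rel G i j) (rel G i k) (rel G i l) (rel G j k) (rel G j l) (rel G k l)

opaque

  lt : ∀ {d} → Fin d → Fin d → ℕ
  lt i j with i <? j
  ... | yes _ = 1
  ... | no _  = 0

  lt-yes : ∀ {d} {i j : Fin d} → i <ᶠ j → lt i j ≡ 1
  lt-yes {i = i} {j} i<j with i <? j
  ... | yes _ = refl
  ... | no i≮j = ⊥-elim (i≮j i<j)

  lt-no : ∀ {d} {i j : Fin d} → ¬ i <ᶠ j → lt i j ≡ 0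
  lt-no {i = i} {j} i≮j with i <? j
  ... | yes i<j = ⊥-elim (i≮j i<j)
  ... | no _ = refl

module _ {d} (G : Graph d) where

  lex : Fin d → Fin d → Fin d → Fin d → ℕ
  lex i j k l = lt i k + isSame (rel G i k) * lt j l

  -- The order factors keep one of the eight quadruples that name the same two edges.
  χ : Fin d → Fin d → Fin d → Fin d → ℕ
  χ i j k l = lt i j * (lt k l * (lex i j k l * onQuad score G i j k l))

  χ-eval : ∀ {i j k l ij ik il jk jl kl} → i <ᶠ j → k <ᶠ l → lex i j k l ≡ 1 →
    rel G i j ≡ ij → rel G i k ≡ ik → rel G i l ≡ il →
    rel G j k ≡ jk → rel G j l ≡ jl → rel G k l ≡ kl →
    χ i j k l ≡ score ij ik il jk jl kl
  χ-eval {i} {j} {k} {l} i<j k<l lx refl refl refl refl refl refl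
    rewrite lt-yes i<j | lt-yes k<l | lx = begin
      1 * (1 * (1 * s))  ≡⟨ ℕ.*-identityˡ _ ⟩
      1 * (1 * s)        ≡⟨ ℕ.*-identityˡ _ ⟩
      1 * s              ≡⟨ ℕ.*-identityˡ s ⟩
      s                  ∎
    where
    open ≡-Reasoning
    s = onQuad score G i j k l

  lex-yes : ∀ {i j k l} → (i <ᶠ k) ⊎ ((i ≡ k) × (j <ᶠ l)) → lex i j k l ≡ 1
  lex-yes {i} {j} {k} {l} (inj₁ i<k)
    rewrite lt-yes i<k with rel G i k in eq
  ... | same = ⊥-elim (Fin.<⇒≢ i<k (rel-same⁻¹ G eq))
  ... | edge = refl
  ... | non = refl
  lex-yes {i} {j} {k} {l} (inj₂ (refl , j<l))
    rewrite lt-no {i = i} {i} (Fin.<-irrefl refl) | rel-refl G i | lt-yes j<l = refl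

  lex-no : ∀ {i j k l} → ¬ ((i <ᶠ k) ⊎ ((i ≡ k) × (j <ᶠ l))) → lex i j k l ≡ 0
  lex-no {i} {j} {k} {l} ¬lex
    rewrite lt-no (¬lex ∘ inj₁) with rel G i k in eq
  ... | same rewrite lt-no (λ j<l → ¬lex (inj₂ (rel-same⁻¹ G eq , j<l))) = refl
  ... | edge = refl
  ... | non = refl

  private
    data Lex (i j k l : Fin d) : Set where
      first  : i <ᶠ k → Lex i j k l
      second : i ≡ k → j <ᶠ l → Lex i j k l
      neither : ¬ ((i <ᶠ k) ⊎ ((i ≡ k) × (j <ᶠ l))) → Lex i j k l

    lex? : ∀ i j k l → Lex i j k l
    lex? i j k l with i <? k | i ≟ k | j <? l
    ... | yes p | _ | _ = first p
    ... | no _ | yes p | yes q = second p q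
    ... | no p | no q | _ = neither λ { (inj₁ r) → p r ; (inj₂ (r , _)) → q r }
    ... | no p | _ | no q = neither λ { (inj₁ r) → p r ; (inj₂ (_ , r)) → q r }

    module _ {i j k l} (i<j : i <ᶠ j) (k<l : k <ᶠ l) (i<k : i <ᶠ k)
             (ij : rel G i j ≡ edge) (kl : rel G k l ≡ edge) where

      i≢j : i ≢ j
      i≢j = Fin.<⇒≢ i<j
      k≢l : k ≢ l
      k≢l = Fin.<⇒≢ k<l
      i≢k : i ≢ k
      i≢k = Fin.<⇒≢ i<k
      i≢l : i ≢ l
      i≢l = Fin.<⇒≢ (Fin.<-trans i<k k<l)

      expose : ∀ {n} → Exposed G i j k l → n ≡ 1 → Indicates (IsPolytopeEdge G i j k l) n
      expose e eq = inj₁ (exposed⇒polytopeEdge G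
        (i<j , rel-edge⁻¹ G ij) (k<l , rel-edge⁻¹ G kl) (inj₁ i<k) e , eq)

      refute : ∀ {n} → ¬ Exposed G i j k l → n ≡ 0 → Indicates (IsPolytopeEdge G i j k l) n
      refute ¬e eq = inj₂ (¬e ∘ polytopeEdge⇒exposed G , eq)

      module _ (j≢k : j ≢ k) (j≢l : j ≢ l) where

        -- If each of the two other matchings lacks a pair, the two missing pairs meet in one of
        -- `i`, `j`, `k`, `l`. This vertex has no neighbour in the opposite edge, and symmetry moves
        -- it to the first place of `exposed-disjoint`; hence four variants.
        lonely-i : rel G i k ≡ non → rel G i l ≡ non → Exposed G i j k l
        lonely-i ik il = exposed-disjoint G (i≢j ∘ sym) (i≢k ∘ sym) (j≢k ∘ sym) (i≢l ∘ sym) (j≢l ∘ sym)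
          (rel-non⁻¹ G ik) (rel-non⁻¹ G il)

        lonely-j : rel G j k ≡ non → rel G j l ≡ non → Exposed G i j k l
        lonely-j jk jl = exposed-flip₁ G (exposed-disjoint G i≢j (j≢k ∘ sym) (i≢k ∘ sym) (j≢l ∘ sym) (i≢l ∘ sym)
          (rel-non⁻¹ G jk) (rel-non⁻¹ G jl))

        lonely-k : rel G i k ≡ non → rel G j k ≡ non → Exposed G i j k l
        lonely-k ik jk = exposed-pairs G (exposed-disjoint G (k≢l ∘ sym) i≢k i≢l j≢k j≢l
          (rel-non⁻¹ G (trans (rel-sym G k i) ik)) (rel-non⁻¹ G (trans (rel-sym G k j) jk)))

        lonely-l : rel G i l ≡ non → rel G j l ≡ non → Exposed G i j k l
        lonely-l il jl = exposed-pairs G (exposed-flip₁ G (exposed-disjoint G k≢l i≢l i≢k j≢l j≢k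
          (rel-non⁻¹ G (trans (rel-sym G l i) il)) (rel-non⁻¹ G (trans (rel-sym G l j) jl))))

        cycle₁ : rel G i k ≡ edge → rel G j l ≡ edge → ¬ Exposed G i j k l
        cycle₁ ik jl = ¬exposed-4-cycle G i≢k i≢l j≢k j≢l (rel-edge⁻¹ G ik) (rel-edge⁻¹ G jl)

        cycle₂ : rel G i l ≡ edge → rel G j k ≡ edge → ¬ Exposed G i j k l
        cycle₂ il jk = ¬exposed-4-cycle G i≢l i≢k j≢l j≢k (rel-edge⁻¹ G il) (rel-edge⁻¹ G jk) ∘ exposed-flip₂ G

      χ≡ : ∀ {ik il jk jl} → rel G i k ≡ ik → rel G i l ≡ il → rel G j k ≡ jk → rel G j l ≡ jl →
           χ i j k l ≡ score edge ik il jk jl edge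
      χ≡ ik il jk jl = χ-eval i<j k<l (lex-yes (inj₁ i<k)) ij ik il jk jl kl

      χ-middle : j ≡ k → ∀ il → rel G i l ≡ il → χ i j k l ≡ 1
      χ-middle _    same il = ⊥-elim (i≢l (rel-same⁻¹ G il))
      χ-middle refl edge il = χ≡ ij il (rel-refl G j) kl
      χ-middle refl non  il = χ≡ ij il (rel-refl G j) kl

      χ-last : j ≡ l → ∀ ik → rel G i k ≡ ik → χ i j k l ≡ 1
      χ-last _    same ik = ⊥-elim (i≢k (rel-same⁻¹ G ik))
      χ-last refl edge ik = χ≡ ik ij (trans (rel-sym G j k) kl) (rel-refl G j)
      χ-last refl non  ik = χ≡ ik ij (trans (rel-sym G j k) kl) (rel-refl G j)

      middle : j ≡ k → Exposed G i j k l
      middle refl = exposed-path G i≢j (k≢l ∘ sym)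

      last : j ≡ l → Exposed G i j k l
      last refl = exposed-flip₂ G (exposed-path G i≢j k≢l)

      disjoint : j ≢ k → j ≢ l → ∀ ik il jk jl → rel G i k ≡ ik → rel G i l ≡ il → rel G j k ≡ jk → rel G j l ≡ jl →
        Indicates (IsPolytopeEdge G i j k l) (χ i j k l)
      disjoint j≢k j≢l same _ _ _ a b c e = ⊥-elim (i≢k (rel-same⁻¹ G a))
      disjoint j≢k j≢l _ same _ _ a b c e = ⊥-elim (i≢l (rel-same⁻¹ G b))
      disjoint j≢k j≢l _ _ same _ a b c e = ⊥-elim (j≢k (rel-same⁻¹ G c))
      disjoint j≢k j≢l _ _ _ same a b c e = ⊥-elim (j≢l (rel-same⁻¹ G e))
      disjoint j≢k j≢l edge edge edge edge a b c e = refute (cycle₁ j≢k j≢l a e) (χ≡ a b c e)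
      disjoint j≢k j≢l edge edge edge non  a b c e = refute (cycle₂ j≢k j≢l b c) (χ≡ a b c e)
      disjoint j≢k j≢l edge edge non  edge a b c e = refute (cycle₁ j≢k j≢l a e) (χ≡ a b c e)
      disjoint j≢k j≢l edge edge non  non  a b c e = expose (lonely-j j≢k j≢l c e) (χ≡ a b c e)
      disjoint j≢k j≢l edge non  edge edge a b c e = refute (cycle₁ j≢k j≢l a e) (χ≡ a b c e)
      disjoint j≢k j≢l edge non  edge non  a b c e = expose (lonely-l j≢k j≢l b e) (χ≡ a b c e)
      disjoint j≢k j≢l edge non  non  edge a b c e = refute (cycle₁ j≢k j≢l a e) (χ≡ a b c e)
      disjoint j≢k j≢l edge non  non  non  a b c e = expose (lonely-j j≢k j≢l c e) (χ≡ a b c e)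
      disjoint j≢k j≢l non  edge edge edge a b c e = refute (cycle₂ j≢k j≢l b c) (χ≡ a b c e)
      disjoint j≢k j≢l non  edge edge non  a b c e = refute (cycle₂ j≢k j≢l b c) (χ≡ a b c e)
      disjoint j≢k j≢l non  edge non  edge a b c e = expose (lonely-k j≢k j≢l a c) (χ≡ a b c e)
      disjoint j≢k j≢l non  edge non  non  a b c e = expose (lonely-j j≢k j≢l c e) (χ≡ a b c e)
      disjoint j≢k j≢l non  non  edge edge a b c e = expose (lonely-i j≢k j≢l a b) (χ≡ a b c e)
      disjoint j≢k j≢l non  non  edge non  a b c e = expose (lonely-i j≢k j≢l a b) (χ≡ a b c e)
      disjoint j≢k j≢l non  non  non  edge a b c e = expose (lonely-i j≢k j≢l a b) (χ≡ a b c e)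
      disjoint j≢k j≢l non  non  non  non  a b c e = expose (lonely-i j≢k j≢l a b) (χ≡ a b c e)

      -- As `i` precedes `k` and `k` precedes `l`, a common vertex can only be `j`. Edges with the
      -- same smaller endpoint fall under the second lexicographic alternative and are treated
      -- apart.
      indicates-lex : Indicates (IsPolytopeEdge G i j k l) (χ i j k l)
      indicates-lex with j ≟ k | j ≟ l
      ... | yes j≡k | _ = expose (middle j≡k) (χ-middle j≡k _ refl)
      ... | no _ | yes j≡l = expose (last j≡l) (χ-last j≡l _ refl)
      ... | no j≢k | no j≢l = disjoint j≢k j≢l _ _ _ _ refl refl refl refl

    χ-first : ∀ {i j l} → i <ᶠ j → i <ᶠ l → j <ᶠ l → rel G i j ≡ edge → rel G i l ≡ edge →
      ∀ jl → rel G j l ≡ jl → χ i j i l ≡ 1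
    χ-first i<j i<l j<l ij il same jl = ⊥-elim (Fin.<⇒≢ j<l (rel-same⁻¹ G jl))
    χ-first {i} {j} i<j i<l j<l ij il edge jl = χ-eval i<j i<l (lex-yes (inj₂ (refl , j<l)))
      ij (rel-refl G i) il (trans (rel-sym G j i) ij) jl il
    χ-first {i} {j} i<j i<l j<l ij il non jl = χ-eval i<j i<l (lex-yes (inj₂ (refl , j<l)))
      ij (rel-refl G i) il (trans (rel-sym G j i) ij) jl il

    χ-zero : ∀ {i j k l} → lex i j k l ≡ 0 ⊎ onQuad score G i j k l ≡ 0 → χ i j k l ≡ 0
    χ-zero {i} {j} {k} {l} p = trans (cong (λ z → lt i j * (lt k l * z)) (zero-factor p))
      (trans (cong (lt i j *_) (ℕ.*-zeroʳ (lt k l))) (ℕ.*-zeroʳ (lt i j)))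
      where
      zero-factor : lex i j k l ≡ 0 ⊎ onQuad score G i j k l ≡ 0 → lex i j k l * onQuad score G i j k l ≡ 0
      zero-factor (inj₁ eq) = cong (_* onQuad score G i j k l) eq
      zero-factor (inj₂ eq) = trans (cong (lex i j k l *_) eq) (ℕ.*-zeroʳ (lex i j k l))

    ¬edge : ∀ {i j} → rel G i j ≡ non → ¬ IsEdge G i j
    ¬edge eq (_ , ij) with () ← trans (sym eq) (rel-edge G ij)

    score-non₁ : ∀ {i j k l} → rel G i j ≡ non → onQuad score G i j k l ≡ 0
    score-non₁ {i} {j} ij rewrite ij = refl

    score-non₂ : ∀ {i j k l} → rel G i j ≡ edge → rel G k l ≡ non → onQuad score G i j k l ≡ 0
    score-non₂ {i} {j} {k} {l} ij kl rewrite ij | kl = refl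

    indicates-ordered : ∀ {i j k l} → i <ᶠ j → k <ᶠ l → Lex i j k l →
      ∀ ij kl → rel G i j ≡ ij → rel G k l ≡ kl → Indicates (IsPolytopeEdge G i j k l) (χ i j k l)
    indicates-ordered i<j k<l (neither ¬lex) _ _ _ _ =
      inj₂ ((λ (_ , _ , lx , _) → ¬lex lx) , χ-zero (inj₁ (lex-no ¬lex)))
    indicates-ordered i<j k<l _ same _ ij kl = ⊥-elim (Fin.<⇒≢ i<j (rel-same⁻¹ G ij))
    indicates-ordered i<j k<l _ _ same ij kl = ⊥-elim (Fin.<⇒≢ k<l (rel-same⁻¹ G kl))
    indicates-ordered i<j k<l _ non _ ij kl =
      inj₂ (¬edge ij ∘ proj₁ , χ-zero (inj₂ (score-non₁ ij)))
    indicates-ordered i<j k<l _ edge non ij kl =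
      inj₂ (¬edge kl ∘ proj₁ ∘ proj₂ , χ-zero (inj₂ (score-non₂ ij kl)))
    indicates-ordered i<j k<l (first i<k) edge edge ij kl = indicates-lex i<j k<l i<k ij kl
    indicates-ordered i<j i<l (second refl j<l) edge edge ij il = inj₁
      (exposed⇒polytopeEdge G (i<j , rel-edge⁻¹ G ij) (i<l , rel-edge⁻¹ G il) (inj₂ (refl , j<l))
        (exposed-flip₁ G (exposed-path G (Fin.<⇒≢ i<j ∘ sym) (Fin.<⇒≢ i<l ∘ sym)))
      , χ-first i<j i<l j<l ij il _ refl)

  indicates : ∀ i j k l → Indicates (IsPolytopeEdge G i j k l) (χ i j k l)
  indicates i j k l = case (i <? j) (k <? l)
    where
    case : Dec (i <ᶠ j) → Dec (k <ᶠ l) → Indicates (IsPolytopeEdge G i j k l) (χ i j k l)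
    case (no i≮j) _ = inj₂ ((λ ((i<j , _) , _) → i≮j i<j) ,
      cong (_* (lt k l * (lex i j k l * onQuad score G i j k l))) (lt-no i≮j))
    case (yes _) (no k≮l) = inj₂ ((λ (_ , (k<l , _) , _) → k≮l k<l) ,
      trans (cong (λ z → lt i j * (z * (lex i j k l * onQuad score G i j k l))) (lt-no k≮l)) (ℕ.*-zeroʳ (lt i j)))
    case (yes i<j) (yes k<l) = indicates-ordered i<j k<l (lex? i j k l) _ _ refl refl

  numPolytopeEdges-unique : ∀ {n} → NumPolytopeEdges G n → n ≡ ∑⁴ d χ
  numPolytopeEdges-unique c =
    trans (countIn-unique (λ (i , j , k , l) → indicates i j k l) c) (sumList-allQuads d _)

  -- For d ≥ 15 the counts have to be exhibited; in the other cases they are given and uniqueness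
  -- suffices.
  numPolytopeEdges-exists : NumPolytopeEdges G (∑⁴ d χ)
  numPolytopeEdges-exists = subst (NumPolytopeEdges G) (sumList-allQuads d _)
    (countIn-exists (λ (i , j , k , l) → indicates i j k l) (allQuads d))

-- Charging to the edges of the complement

∀Rel? : {P : Rel → Set} → (∀ r → Dec (P r)) → Dec (∀ r → P r)
∀Rel? P? = map′ (λ { (s , e , n) same → s ; (s , e , n) edge → e ; (s , e , n) non → n })
  (λ p → p same , p edge , p non) (P? same ×-dec P? edge ×-dec P? non)

agree? : (φ ψ : Rel⁶→ℕ) → Dec (∀ a b c e f g → φ a b c e f g ≡ ψ a b c e f g)
agree? φ ψ = ∀Rel? λ a → ∀Rel? λ b → ∀Rel? λ c → ∀Rel? λ e → ∀Rel? λ f → ∀Rel? λ g →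
  φ a b c e f g ℕ.≟ ψ a b c e f g

-- The action of a transposition of two vertices on the six relations between four vertices, each
-- relation being rewritten with its indices in the fixed order.
p₁₂ p₁₃ p₂₃ p₁₄ p₂₄ p₃₄ : Rel⁶→ℕ → Rel⁶→ℕ
p₁₂ φ ij ik il jk jl kl = φ ij jk jl ik il kl
p₁₃ φ ij ik il jk jl kl = φ jk ik kl ij jl il
p₂₃ φ ij ik il jk jl kl = φ ik ij il jk kl jl
p₁₄ φ ij ik il jk jl kl = φ jl kl il jk ij ik
p₂₄ φ ij ik il jk jl kl = φ il ik ij kl jl jk
p₃₄ φ ij ik il jk jl kl = φ ij il ik jl jk kl

_⊞_ : Rel⁶→ℕ → Rel⁶→ℕ → Rel⁶→ℕ
(φ ⊞ ψ) a b c e f g = φ a b c e f g + ψ a b c e f g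

symRel₂ symRel₃ symRel₄ symRel : Rel⁶→ℕ → Rel⁶→ℕ
symRel₂ φ = φ ⊞ p₁₂ φ
symRel₃ φ = φ ⊞ (p₁₃ φ ⊞ p₂₃ φ)
symRel₄ φ = φ ⊞ (p₁₄ φ ⊞ (p₂₄ φ ⊞ p₃₄ φ))
symRel φ = symRel₄ (symRel₃ (symRel₂ φ))

-- Adjacency of x to u and v in the complement, whose edges are the pairs in relation non.
private-nbr₁ private-nbr₂ common-nbr common-non : Rel → Rel → ℕ
private-nbr₁ ux vx = isNon ux * isEdge vx
private-nbr₂ ux vx = isEdge ux * isNon vx
common-nbr   ux vx = isNon ux * isNon vx
common-non   ux vx = isEdge ux * isEdge vx

-- The share of the 4-set {u,v,x,y} assigned to its complement edge uv. Per tuple,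
-- C₄ and the middle edge of P₄ get 2, an end edge of P₄ gets 3, P₃ + K₁ gets 4;
-- over all orderings of the 4-set these add up to 16 in each of the three cases.
charge′ : Rel → Rel → Rel → Rel → Rel → ℕ
charge′ ux uy vx vy xy =
  2 * (private-nbr₁ ux vx * private-nbr₂ uy vy) * distinct xy +
  (private-nbr₁ ux vx + private-nbr₂ ux vx) * common-non uy vy * (4 * isEdge xy + 3 * isNon xy)

charge : Rel⁶→ℕ
charge uv ux uy vx vy xy = isNon uv * charge′ ux uy vx vy xy

-- A 4-set with a unique perfect matching in G has eight orderings that list this matching; doubled,
-- they match the total of 16 in `charge`.
2lone : Rel⁶→ℕ
2lone a b c e f g = 2 * lone a b c e f g

-- Evaluated on all 729 sextuples of relations, including those that no four vertices realise; no
-- consistency between the relations has to be assumed.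
symRel-charge : ∀ a b c e f g → symRel 2lone a b c e f g ≡ symRel charge a b c e f g
symRel-charge = toWitness {a? = agree? (symRel 2lone) (symRel charge)} _

score-p₁₂ : ∀ a b c e f g → score a b c e f g ≡ p₁₂ score a b c e f g
score-p₁₂ = toWitness {a? = agree? score (p₁₂ score)} _

score-p₃₄ : ∀ a b c e f g → score a b c e f g ≡ p₃₄ score a b c e f g
score-p₃₄ = toWitness {a? = agree? score (p₃₄ score)} _

score-pairs : ∀ a b c e f g → score a b c e f g ≡ p₁₃ (p₂₄ score) a b c e f g
score-pairs = toWitness {a? = agree? score (p₁₃ (p₂₄ score))} _

module _ {d} (G : Graph d) where

  private
    r : Fin d → Fin d → Rel
    r = rel G

  module _ (φ : Rel⁶→ℕ) (i j k l : Fin d) where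

    onQuad-p₁₂ : onQuad φ G j i k l ≡ onQuad (p₁₂ φ) G i j k l
    onQuad-p₁₂ rewrite rel-sym G j i = refl

    onQuad-p₁₃ : onQuad φ G k j i l ≡ onQuad (p₁₃ φ) G i j k l
    onQuad-p₁₃ rewrite rel-sym G k j | rel-sym G k i | rel-sym G j i = refl

    onQuad-p₂₃ : onQuad φ G i k j l ≡ onQuad (p₂₃ φ) G i j k l
    onQuad-p₂₃ rewrite rel-sym G k j = refl

    onQuad-p₁₄ : onQuad φ G l j k i ≡ onQuad (p₁₄ φ) G i j k l
    onQuad-p₁₄ rewrite rel-sym G l j | rel-sym G l k | rel-sym G l i | rel-sym G j i | rel-sym G k i = refl

    onQuad-p₂₄ : onQuad φ G i l k j ≡ onQuad (p₂₄ φ) G i j k l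
    onQuad-p₂₄ rewrite rel-sym G l k | rel-sym G l j | rel-sym G k j = refl

    onQuad-p₃₄ : onQuad φ G i j l k ≡ onQuad (p₃₄ φ) G i j k l
    onQuad-p₃₄ rewrite rel-sym G l k = refl

  onQuad-symmetrise : ∀ φ i j k l → symmetrise (onQuad φ G) i j k l ≡ onQuad (symRel φ) G i j k l
  onQuad-symmetrise φ i j k l = four (symRel₃ (symRel₂ φ)) (three (symRel₂ φ) (two φ)) i j k l
    where
    _≗⁴_ : (f g : Fin d → Fin d → Fin d → Fin d → ℕ) → Set
    f ≗⁴ g = ∀ i j k l → f i j k l ≡ g i j k l
    two : ∀ φ → sym₂ (onQuad φ G) ≗⁴ onQuad (symRel₂ φ) G
    two φ i j k l = cong (onQuad φ G i j k l +_) (onQuad-p₁₂ φ i j k l)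
    three : ∀ {f} φ → f ≗⁴ onQuad φ G → sym₃ f ≗⁴ onQuad (symRel₃ φ) G
    three φ eq i j k l = cong₂ _+_ (eq i j k l) (cong₂ _+_
      (trans (eq k j i l) (onQuad-p₁₃ φ i j k l)) (trans (eq i k j l) (onQuad-p₂₃ φ i j k l)))
    four : ∀ {f} φ → f ≗⁴ onQuad φ G → sym₄ f ≗⁴ onQuad (symRel₄ φ) G
    four φ eq i j k l = cong₂ _+_ (eq i j k l) (cong₂ _+_
      (trans (eq l j k i) (onQuad-p₁₄ φ i j k l)) (cong₂ _+_
      (trans (eq i l k j) (onQuad-p₂₄ φ i j k l)) (trans (eq i j l k) (onQuad-p₃₄ φ i j k l))))

  -- The two sides look at different orderings of a 4-set: `lone` wants edges of G in places 1, 2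
  -- and 3, 4, `charge` an edge of H in places 1, 2. They agree only after symmetrisation, whose
  -- factor 24 is then cancelled.
  ∑-lone≡∑-charge : 2 * ∑⁴ d (onQuad lone G) ≡ ∑⁴ d (onQuad charge G)
  ∑-lone≡∑-charge = trans (sym (∑⁴-* 2 (onQuad lone G))) (ℕ.*-cancelˡ-≡ _ _ 24 (begin
    24 * ∑⁴ d (onQuad 2lone G)           ≡⟨ ∑⁴-symmetrise d (onQuad 2lone G) ⟨
    ∑⁴ d (symmetrise (onQuad 2lone G))   ≡⟨ ∑⁴-cong (onQuad-symmetrise 2lone) ⟩
    ∑⁴ d (onQuad (symRel 2lone) G)       ≡⟨ ∑⁴-cong (λ i j k l → symRel-charge (r i j) (r i k) (r i l) (r j k) (r j l) (r k l)) ⟩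
    ∑⁴ d (onQuad (symRel charge) G)      ≡⟨ ∑⁴-cong (onQuad-symmetrise charge) ⟨
    ∑⁴ d (symmetrise (onQuad charge G))  ≡⟨ ∑⁴-symmetrise d (onQuad charge G) ⟩
    24 * ∑⁴ d (onQuad charge G)          ∎))
    where open ≡-Reasoning

  lt-trichotomy : ∀ i j → lt i j + lt j i + isSame (r i j) ≡ 1
  lt-trichotomy i j with Fin.<-cmp i j
  ... | tri≈ i≮i refl _ rewrite lt-no i≮i | rel-refl G i = refl
  ... | tri< i<j i≢j j≮i with r i j in eq
  ...   | same = ⊥-elim (i≢j (rel-same⁻¹ G eq))
  ...   | edge rewrite lt-yes i<j | lt-no j≮i = refl
  ...   | non  rewrite lt-yes i<j | lt-no j≮i = refl
  lt-trichotomy i j | tri> i≮j i≢j j<i with r i j in eq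
  ...   | same = ⊥-elim (i≢j (rel-same⁻¹ G eq))
  ...   | edge rewrite lt-yes j<i | lt-no i≮j = refl
  ...   | non  rewrite lt-yes j<i | lt-no i≮j = refl

-- The counting identity

module _ {d} (G : Graph d) where

  private
    r : Fin d → Fin d → Rel
    r = rel G

    F : Fin d → Fin d → Fin d → Fin d → ℕ
    F = onQuad score G

    split : ∀ a b s f → a + b + s ≡ 1 → s * f ≡ 0 → f ≡ a * f + b * f
    split a b s f eq z = begin
      f                      ≡⟨ ℕ.*-identityˡ f ⟨
      1 * f                  ≡⟨ cong (_* f) eq ⟨
      (a + b + s) * f        ≡⟨ ℕ.*-distribʳ-+ f (a + b) s ⟩
      (a + b) * f + s * f    ≡⟨ cong₂ _+_ (ℕ.*-distribʳ-+ f a b) z ⟩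
      (a * f + b * f) + 0    ≡⟨ ℕ.+-identityʳ _ ⟩
      a * f + b * f          ∎
      where open ≡-Reasoning

    halve : ∀ f g g′ → ∑⁴ d g ≡ ∑⁴ d g′ →
      (∀ i j k l → f i j k l ≡ g i j k l + g′ i j k l) → ∑⁴ d f ≡ 2 * ∑⁴ d g
    halve f g g′ gg′ eq = trans (∑⁴-cong eq)
      (trans (∑⁴-+ g g′) (trans (cong (∑⁴ d g +_) (sym gg′)) (twice (∑⁴ d g))))
      where
      twice : ∀ x → x + x ≡ 2 * x
      twice = solve-∀

    score-loop : ∀ i j k l → isSame (r i j) * F i j k l ≡ 0
    score-loop i j k l = on (r i j) (r i k) (r i l) (r j k) (r j l) (r k l)
      where
      on : ∀ ij a b c e f → isSame ij * score ij a b c e f ≡ 0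
      on same _ _ _ _ _ = refl
      on edge _ _ _ _ _ = refl
      on non  _ _ _ _ _ = refl

    -- Comparing two edges lexicographically leaves over only the case that they coincide, and this
    -- case contributes nothing.
    same-pair : ∀ i j → F i j i j ≡ 0
    same-pair i j rewrite rel-refl G i | rel-refl G j | rel-sym G j i with r i j
    ... | same = refl
    ... | edge = refl
    ... | non  = refl

    F-swap₁₂ : ∀ i j k l → F j i k l ≡ F i j k l
    F-swap₁₂ i j k l = trans (onQuad-p₁₂ G score i j k l)
      (sym (score-p₁₂ (r i j) (r i k) (r i l) (r j k) (r j l) (r k l)))

    F-swap₃₄ : ∀ i j k l → F i j l k ≡ F i j k l
    F-swap₃₄ i j k l = trans (onQuad-p₃₄ G score i j k l)
      (sym (score-p₃₄ (r i j) (r i k) (r i l) (r j k) (r j l) (r k l)))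

    F-pairs : ∀ i j k l → F k l i j ≡ F i j k l
    F-pairs i j k l = trans (onQuad-p₂₄ G score k j i l) (trans (onQuad-p₁₃ G (p₂₄ score) i j k l)
      (sym (score-pairs (r i j) (r i k) (r i l) (r j k) (r j l) (r k l))))

    F₁ F₂ F₃ : Fin d → Fin d → Fin d → Fin d → ℕ
    F₁ i j k l = lt i j * F i j k l
    F₂ i j k l = lt k l * F₁ i j k l
    F₃ i j k l = lex G i j k l * F₂ i j k l

    step₁ : ∑⁴ d F ≡ 2 * ∑⁴ d F₁
    step₁ = halve F F₁ _ (∑⁴-swap₁₂ F₁) λ i j k l →
      trans (split (lt i j) (lt j i) (isSame (r i j)) (F i j k l) (lt-trichotomy G i j) (score-loop i j k l))
        (cong (λ z → lt i j * F i j k l + lt j i * z) (sym (F-swap₁₂ i j k l)))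

    step₂ : ∑⁴ d F₁ ≡ 2 * ∑⁴ d F₂
    step₂ = halve F₁ F₂ _ (∑⁴-swap₃₄ F₂) λ i j k l →
      trans (split (lt k l) (lt l k) (isSame (r k l)) (F₁ i j k l) (lt-trichotomy G k l) (vanish i j k l))
        (cong (λ z → lt k l * F₁ i j k l + lt l k * (lt i j * z)) (sym (F-swap₃₄ i j k l)))
      where
      vanish : ∀ i j k l → isSame (r k l) * F₁ i j k l ≡ 0
      vanish i j k l = begin
        isSame (r k l) * (lt i j * F i j k l)  ≡⟨ cong (λ z → isSame (r k l) * (lt i j * z)) (F-pairs i j k l) ⟨
        isSame (r k l) * (lt i j * F k l i j)  ≡⟨ rearrange (isSame (r k l)) (lt i j) (F k l i j) ⟩
        lt i j * (isSame (r k l) * F k l i j)  ≡⟨ cong (lt i j *_) (score-loop k l i j) ⟩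
        lt i j * 0                             ≡⟨ ℕ.*-zeroʳ (lt i j) ⟩
        0                                      ∎
        where
        open ≡-Reasoning
        rearrange : ∀ a b c → a * (b * c) ≡ b * (a * c)
        rearrange = solve-∀

    lex-trichotomy : ∀ i j k l → lex G i j k l + lex G k l i j + isSame (r i k) * isSame (r j l) ≡ 1
    lex-trichotomy i j k l rewrite rel-sym G k i = begin
      lt i k + s * lt j l + (lt k i + s * lt l j) + s * isSame (r j l)
        ≡⟨ rearrange (lt i k) (lt k i) s (lt j l) (lt l j) (isSame (r j l)) ⟩
      lt i k + lt k i + s * (lt j l + lt l j + isSame (r j l))
        ≡⟨ cong (λ z → lt i k + lt k i + s * z) (lt-trichotomy G j l) ⟩
      lt i k + lt k i + s * 1
        ≡⟨ cong (lt i k + lt k i +_) (ℕ.*-identityʳ s) ⟩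
      lt i k + lt k i + s
        ≡⟨ lt-trichotomy G i k ⟩
      1 ∎
      where
      open ≡-Reasoning
      s = isSame (r i k)
      rearrange : ∀ a b s x y z → a + s * x + (b + s * y) + s * z ≡ a + b + s * (x + y + z)
      rearrange = solve-∀

    step₃ : ∑⁴ d F₂ ≡ 2 * ∑⁴ d F₃
    step₃ = halve F₂ F₃ _ (∑⁴-swap-pairs F₃) λ i j k l →
      trans (split (lex G i j k l) (lex G k l i j) (isSame (r i k) * isSame (r j l)) (F₂ i j k l)
          (lex-trichotomy i j k l) (vanish i j k l))
        (cong (lex G i j k l * F₂ i j k l +_) (cong (lex G k l i j *_) (F₂-pairs i j k l)))
      where
      F₂-pairs : ∀ i j k l → F₂ i j k l ≡ F₂ k l i j
      F₂-pairs i j k l = trans (rearrange (lt k l) (lt i j) (F i j k l))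
        (cong (λ z → lt i j * (lt k l * z)) (sym (F-pairs i j k l)))
        where
        rearrange : ∀ a b c → a * (b * c) ≡ b * (a * c)
        rearrange = solve-∀
      vanish : ∀ i j k l → isSame (r i k) * isSame (r j l) * F₂ i j k l ≡ 0
      vanish i j k l = on (r i k) (r j l) refl refl
        where
        on : ∀ ik jl → r i k ≡ ik → r j l ≡ jl → isSame ik * isSame jl * F₂ i j k l ≡ 0
        on same edge _ _ = refl
        on same non  _ _ = refl
        on edge _    _ _ = refl
        on non  _    _ _ = refl
        on same same ik jl with refl ← rel-same⁻¹ G ik | refl ← rel-same⁻¹ G jl =
          trans (ℕ.+-identityʳ _) (trans (cong (λ z → lt i j * (lt i j * z)) (same-pair i j))
            (trans (cong (lt i j *_) (ℕ.*-zeroʳ (lt i j))) (ℕ.*-zeroʳ (lt i j))))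

  -- Two orders for each edge and two for the pair: `score` is invariant under all three exchanges,
  -- so each of the conditions `lt i j`, `lt k l` and `lex` halves the sum.
  ∑-score : ∑⁴ d (onQuad score G) ≡ 8 * ∑⁴ d (χ G)
  ∑-score = begin
    ∑⁴ d F                   ≡⟨ step₁ ⟩
    2 * ∑⁴ d F₁              ≡⟨ cong (2 *_) step₂ ⟩
    2 * (2 * ∑⁴ d F₂)        ≡⟨ cong (λ z → 2 * (2 * z)) step₃ ⟩
    2 * (2 * (2 * ∑⁴ d F₃))  ≡⟨ arith (∑⁴ d F₃) ⟩
    8 * ∑⁴ d F₃              ≡⟨ cong (8 *_) (∑⁴-cong λ i j k l → rearrange (lt i j) (lt k l) (lex G i j k l) (F i j k l)) ⟩
    8 * ∑⁴ d (χ G)           ∎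
    where
    open ≡-Reasoning
    arith : ∀ x → 2 * (2 * (2 * x)) ≡ 8 * x
    arith = solve-∀
    rearrange : ∀ a b c f → c * (b * (a * f)) ≡ a * (b * (c * f))
    rearrange = solve-∀

  ∑-same : ∀ i (g : Fin d → ℕ) → ∑ (λ k → isSame (r i k) * g k) ≡ g i
  ∑-same i g = trans (∑-single _ i λ k k≢i → cong (_* g k) (not-same k k≢i))
    (trans (cong (λ z → isSame z * g i) (rel-refl G i)) (ℕ.+-identityʳ (g i)))
    where
    not-same : ∀ k → k ≢ i → isSame (r i k) ≡ 0
    not-same k k≢i with r i k in eq
    ... | same = ⊥-elim (k≢i (sym (rel-same⁻¹ G eq)))
    ... | edge = refl
    ... | non  = refl

  -- The common vertex may occupy any of four pairs of places, all equivalent under renaming.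
  -- Dropping its second occurrence leaves paths with centre `i` and ends `j`, `k`.
  ∑-shared : ∑⁴ d (onQuad shared G) ≡ 4 * ∑³ d (λ i j k → isEdge (r i j) * isEdge (r i k) * distinct (r j k))
  ∑-shared = begin
    ∑⁴ d (onQuad shared G)                              ≡⟨ ∑⁴-cong expand ⟩
    ∑⁴ d (λ i j k l → A i j k l + (A i j l k + (A j i k l + A j i l k)))
                                                        ≡⟨ trans (∑⁴-+ A _) (cong (∑⁴ d A +_)
                                                            (trans (∑⁴-+ A₃₄ _) (cong (∑⁴ d A₃₄ +_) (∑⁴-+ A₁₂ _)))) ⟩
    ∑⁴ d A + (∑⁴ d A₃₄ + (∑⁴ d A₁₂ + ∑⁴ d (λ i j k l → A j i l k)))
                                                        ≡⟨ cong₂ (λ x y → ∑⁴ d A + (x + y)) (sym (∑⁴-swap₃₄ A))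
                                                            (cong₂ _+_ (sym (∑⁴-swap₁₂ A)) (sym (trans (∑⁴-swap₃₄ A) (∑⁴-swap₁₂ A₃₄)))) ⟩
    ∑⁴ d A + (∑⁴ d A + (∑⁴ d A + ∑⁴ d A))               ≡⟨ arith (∑⁴ d A) ⟩
    4 * ∑⁴ d A                                          ≡⟨ cong (4 *_) collapse ⟩
    4 * ∑³ d (λ i j k → isEdge (r i j) * isEdge (r i k) * distinct (r j k)) ∎
    where
    open ≡-Reasoning
    A A₁₂ A₃₄ : Fin d → Fin d → Fin d → Fin d → ℕ
    A i j k l = isSame (r i k) * (isEdge (r i j) * isEdge (r k l) * distinct (r j l))
    A₁₂ i j k l = A j i k l
    A₃₄ i j k l = A i j l k
    arith : ∀ x → x + (x + (x + x)) ≡ 4 * x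
    arith = solve-∀
    distribute : ∀ e f a b c g a′ b′ c′ g′ →
      e * f * (a * a′ + b * b′ + c * c′ + g * g′) ≡
      a * (e * f * a′) + (b * (e * f * b′) + (c * (e * f * c′) + g * (e * f * g′)))
    distribute = solve-∀
    expand : ∀ i j k l → onQuad shared G i j k l ≡ A i j k l + (A i j l k + (A j i k l + A j i l k))
    expand i j k l rewrite rel-sym G j i | rel-sym G l k =
      distribute (isEdge (r i j)) (isEdge (r k l)) (isSame (r i k)) (isSame (r i l)) (isSame (r j k)) (isSame (r j l))
        (distinct (r j l)) (distinct (r j k)) (distinct (r i l)) (distinct (r i k))
    collapse : ∑⁴ d A ≡ ∑³ d (λ i j k → isEdge (r i j) * isEdge (r i k) * distinct (r j k))
    collapse = ∑-cong λ i → ∑-cong λ j → trans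
      (∑-cong λ k → ∑-*ˡ (isSame (r i k)) (λ l → isEdge (r i j) * isEdge (r k l) * distinct (r j l)))
      (∑-same i (λ k → ∑ λ l → isEdge (r i j) * isEdge (r k l) * distinct (r j l)))

  -- Independent of the edges of `G`, hence equal for `G` and `K d`; it is written with the
  -- relations of `G` so that the identities below can be checked pointwise.
  distinctTriples : ℕ
  distinctTriples = ∑³ d λ i j k → distinct (r i j) * distinct (r i k) * distinct (r j k)

  -- For an edge uv of H, the paths P₃ of H through uv, extended at one end or the other. The third
  -- pair is not restricted, so a common neighbour counts twice.
  degree-part : Fin d → Fin d → ℕ
  degree-part u v = ∑ λ x → isNon (r u x) * distinct (r v x) + isNon (r v x) * distinct (r u x)

  others : Fin d → Fin d → ℕ
  others u v = ∑ λ x → distinct (r u x) * distinct (r v x)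

  -- Eight times what uv receives: the 4 stands for half of each P₃, and the values 2, 3, 4 inside
  -- `charge′` for 1/4, 3/8 and 1/2.
  weight : Fin d → Fin d → ℕ
  weight u v = 4 * degree-part u v + ∑² d λ x y → charge′ (r u x) (r u y) (r v x) (r v y) (r x y)

  private
    CE CH X : ℕ
    CE = ∑³ d λ i j k → isEdge (r i j) * isEdge (r i k) * distinct (r j k)
    CH = ∑³ d λ i j k → isNon (r i j) * (isNon (r i k) * distinct (r j k))
    X  = ∑³ d λ i j k → isNon (r i j) * (distinct (r i k) * distinct (r j k))

    -- Inclusion and exclusion on the two legs at the centre `i`: of all distinct triples, remove
    -- those with a given leg in H, once per leg, and restore those with both. The removed terms
    -- stand on the left to avoid truncated subtraction.
    paths : CE + 2 * X ≡ distinctTriples + CH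
    paths = begin
      CE + 2 * X            ≡⟨ cong (CE +_) (cong (X +_) (trans (ℕ.+-identityʳ X) (∑³-swap₂₃ _))) ⟩
      CE + (X + X′)         ≡⟨ cong (CE +_) (∑³-+ _ _) ⟨
      CE + ∑³ d _           ≡⟨ ∑³-+ _ _ ⟨
      ∑³ d (λ i j k → isEdge (r i j) * isEdge (r i k) * distinct (r j k) +
         (isNon (r i j) * (distinct (r i k) * distinct (r j k)) +
          isNon (r i k) * (distinct (r i j) * distinct (r k j))))
                            ≡⟨ ∑³-cong (λ i j k → trans
                                 (cong (λ z → isEdge (r i j) * isEdge (r i k) * distinct (r j k) +
                                    (isNon (r i j) * (distinct (r i k) * distinct (r j k)) +
                                     isNon (r i k) * (distinct (r i j) * distinct z))) (rel-sym G k j))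
                                 (pointwise (r i j) (r i k) (r j k))) ⟩
      ∑³ d (λ i j k → distinct (r i j) * distinct (r i k) * distinct (r j k) + isNon (r i j) * (isNon (r i k) * distinct (r j k)))
                            ≡⟨ ∑³-+ _ _ ⟩
      distinctTriples + CH  ∎
      where
      open ≡-Reasoning
      X′ = ∑³ d λ i j k → isNon (r i k) * (distinct (r i j) * distinct (r k j))
      pointwise : ∀ a b c → isEdge a * isEdge b * distinct c +
        (isNon a * (distinct b * distinct c) + isNon b * (distinct a * distinct c)) ≡
        distinct a * distinct b * distinct c + isNon a * (isNon b * distinct c)
      pointwise = toWitness {a? = ∀Rel? λ a → ∀Rel? λ b → ∀Rel? λ c → _ ℕ.≟ _} _

    -- `CH` lists each P₃ twice, by the order of its ends; the right side meets it four times, from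
    -- either of its edges in either direction.
    cherries : 2 * CH ≡ ∑² d (λ u v → isNon (r u v) * degree-part u v)
    cherries = begin
      2 * CH         ≡⟨ cong (CH +_) (trans (ℕ.+-identityʳ CH) (∑³-swap₁₂ _)) ⟩
      CH + ∑³ d (λ u v x → isNon (r v u) * (isNon (r v x) * distinct (r u x)))  ≡⟨ ∑³-+ _ _ ⟨
      ∑³ d (λ u v x → isNon (r u v) * (isNon (r u x) * distinct (r v x)) +
                      isNon (r v u) * (isNon (r v x) * distinct (r u x)))
                     ≡⟨ ∑²-cong (λ u v → trans (∑-cong λ x → trans
                          (cong (λ z → isNon (r u v) * (isNon (r u x) * distinct (r v x)) +
                                       isNon z * (isNon (r v x) * distinct (r u x))) (rel-sym G v u))
                          (sym (ℕ.*-distribˡ-+ (isNon (r u v)) _ _))) (∑-*ˡ (isNon (r u v)) _)) ⟩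
      ∑² d (λ u v → isNon (r u v) * degree-part u v) ∎
      where open ≡-Reasoning

  -- The negative term again stands on the left. With `others` equal to d - 2, the coefficient
  -- `16 * others` is eight times 2d - 4.
  edge-count : 16 * ∑⁴ d (χ G) + ∑² d (λ u v → isNon (r u v) * (16 * others u v)) ≡
               8 * distinctTriples + ∑² d (λ u v → isNon (r u v) * weight u v)
  edge-count = begin
    16 * n + ∑² d (λ u v → isNon (r u v) * (16 * others u v))
      ≡⟨ cong (16 * n +_) (trans (∑²-cong λ u v → rearrange (isNon (r u v)) 16 (others u v)) (∑²-* 16 _)) ⟩
    16 * n + 16 * ∑² d (λ u v → isNon (r u v) * others u v)
      ≡⟨ cong (λ z → 16 * n + 16 * z) (∑²-cong λ u v → ∑-*ˡ (isNon (r u v)) _) ⟨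
    16 * n + 16 * X
      ≡⟨ cong (_+ 16 * X) (trans (sixteen n) (cong (2 *_) (trans (sym ∑-score) (trans (∑⁴-+ _ _) (cong (_+ L) ∑-shared))))) ⟩
    2 * (4 * CE + L) + 16 * X
      ≡⟨ arith₁ CE L X ⟩
    8 * (CE + 2 * X) + 2 * L
      ≡⟨ cong₂ (λ x y → 8 * x + y) paths (∑-lone≡∑-charge G) ⟩
    8 * (distinctTriples + CH) + ∑⁴ d (onQuad charge G)
      ≡⟨ arith₂ distinctTriples CH _ ⟩
    8 * distinctTriples + (4 * (2 * CH) + ∑⁴ d (onQuad charge G))
      ≡⟨ cong (8 * distinctTriples +_) (begin
        4 * (2 * CH) + ∑⁴ d (onQuad charge G)
          ≡⟨ cong₂ (λ x y → 4 * x + y) cherries (∑²-cong λ u v → trans (∑-cong λ x → ∑-*ˡ (isNon (r u v)) _) (∑-*ˡ (isNon (r u v)) _)) ⟩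
        4 * ∑² d (λ u v → isNon (r u v) * degree-part u v) + ∑² d (λ u v → isNon (r u v) * C u v)
          ≡⟨ cong (_+ ∑² d (λ u v → isNon (r u v) * C u v)) (∑²-* 4 _) ⟨
        ∑² d (λ u v → 4 * (isNon (r u v) * degree-part u v)) + ∑² d (λ u v → isNon (r u v) * C u v)
          ≡⟨ ∑²-+ _ _ ⟨
        ∑² d (λ u v → 4 * (isNon (r u v) * degree-part u v) + isNon (r u v) * C u v)
          ≡⟨ ∑²-cong (λ u v → factor (isNon (r u v)) (degree-part u v) (C u v)) ⟩
        ∑² d (λ u v → isNon (r u v) * weight u v) ∎) ⟩
    8 * distinctTriples + ∑² d (λ u v → isNon (r u v) * weight u v) ∎
    where
    open ≡-Reasoning
    n L : ℕ
    n = ∑⁴ d (χ G)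
    L = ∑⁴ d (onQuad lone G)
    C : Fin d → Fin d → ℕ
    C u v = ∑² d λ x y → charge′ (r u x) (r u y) (r v x) (r v y) (r x y)
    rearrange : ∀ a b c → a * (b * c) ≡ b * (a * c)
    rearrange = solve-∀
    sixteen : ∀ x → 16 * x ≡ 2 * (8 * x)
    sixteen = solve-∀
    arith₁ : ∀ c l x → 2 * (4 * c + l) + 16 * x ≡ 8 * (c + 2 * x) + 2 * l
    arith₁ = solve-∀
    arith₂ : ∀ t c q → 8 * (t + c) + q ≡ 8 * t + (4 * (2 * c) + q)
    arith₂ = solve-∀
    factor : ∀ h a c → 4 * (h * a) + h * c ≡ h * (4 * a + c)
    factor = solve-∀

-- Local bound at an edge of the complement

-- Scaled by 8; the counting identity carries a factor 16 because uv and vu are both summed over.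
localWeight : ℕ → ℕ → ℕ → ℕ → ℕ
localWeight p q t s = 4 * (p + q) + 8 * t + 2 * (p * q) + 4 * ((p + q) * s)

module _ {d} (G : Graph d) where

  private
    r : Fin d → Fin d → Rel
    r = rel G

  -- #escapes counts the H-edges from the private neighbours to the vertices adjacent to neither end,
  -- i.e. the induced P₄ with end edge uv.
  #private₁ #private₂ #common #nonadjacent #escapes : Fin d → Fin d → ℕ
  #private₁    u v = ∑ λ x → private-nbr₁ (r u x) (r v x)
  #private₂    u v = ∑ λ x → private-nbr₂ (r u x) (r v x)
  #common      u v = ∑ λ x → common-nbr (r u x) (r v x)
  #nonadjacent u v = ∑ λ x → common-non (r u x) (r v x)
  #escapes     u v = ∑² d λ x y →
    (private-nbr₁ (r u x) (r v x) + private-nbr₂ (r u x) (r v x)) * common-non (r u y) (r v y) * isNon (r x y)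

  others≡ : ∀ u v → others G u v ≡ #private₁ u v + #private₂ u v + #common u v + #nonadjacent u v
  others≡ u v = trans (∑-cong λ x → pointwise (r u x) (r v x))
    (trans (∑-+ _ _) (cong (_+ #nonadjacent u v) (trans (∑-+ _ _) (cong (_+ #common u v) (∑-+ _ _)))))
    where
    pointwise : ∀ a b → distinct a * distinct b ≡
      private-nbr₁ a b + private-nbr₂ a b + common-nbr a b + common-non a b
    pointwise = toWitness {a? = ∀Rel? λ a → ∀Rel? λ b → _ ℕ.≟ _} _

  others+2 : ∀ {u v} → u ≢ v → others G u v + 2 ≡ d
  others+2 {u} {v} u≢v = begin
    others G u v + 2
      ≡⟨ cong (others G u v +_) (cong₂ _+_ (∑-same G u (λ _ → 1)) (∑-same G v (λ _ → 1))) ⟨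
    others G u v + (∑ (λ x → isSame (r u x) * 1) + ∑ (λ x → isSame (r v x) * 1))
      ≡⟨ trans (cong (others G u v +_) (sym (∑-+ _ _))) (sym (∑-+ _ _)) ⟩
    ∑ (λ x → distinct (r u x) * distinct (r v x) + (isSame (r u x) * 1 + isSame (r v x) * 1))
      ≡⟨ ∑-cong (λ x → pointwise (r u x) (r v x) λ ux vx → u≢v (trans (rel-same⁻¹ G ux) (sym (rel-same⁻¹ G vx)))) ⟩
    ∑ {d} (λ _ → 1)
      ≡⟨ ∑-one d ⟩
    d ∎
    where
    open ≡-Reasoning
    pointwise : ∀ a b → (a ≡ same → b ≡ same → ⊥) → distinct a * distinct b + (isSame a * 1 + isSame b * 1) ≡ 1
    pointwise same same ¬both = ⊥-elim (¬both refl refl)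
    pointwise same edge _ = refl
    pointwise same non  _ = refl
    pointwise edge same _ = refl
    pointwise edge edge _ = refl
    pointwise edge non  _ = refl
    pointwise non  same _ = refl
    pointwise non  edge _ = refl
    pointwise non  non  _ = refl

  degree-part≡ : ∀ u v → degree-part G u v ≡ #private₁ u v + #private₂ u v + 2 * #common u v
  degree-part≡ u v = trans (∑-cong λ x → pointwise (r u x) (r v x))
    (trans (∑-+ _ _) (cong₂ _+_ (∑-+ _ _) (∑-*ˡ 2 _)))
    where
    pointwise : ∀ a b → isNon a * distinct b + isNon b * distinct a ≡
      private-nbr₁ a b + private-nbr₂ a b + 2 * common-nbr a b
    pointwise = toWitness {a? = ∀Rel? λ a → ∀Rel? λ b → _ ℕ.≟ _} _

  -- A pair counted by `#escapes` is charged 3 where a P₃ + K₁ is charged 4, and C₄ and the middle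
  -- edge of P₄ are both charged 2. Adding 1 per escape removes all dependence on the relation of
  -- `x` and `y`, and the double sum splits into products.
  charge-total : ∀ u v →
    ∑² d (λ x y → charge′ (r u x) (r u y) (r v x) (r v y) (r x y)) + #escapes u v ≡
    2 * (#private₁ u v * #private₂ u v) + 4 * ((#private₁ u v + #private₂ u v) * #nonadjacent u v)
  charge-total u v = begin
    ∑² d (λ x y → charge′ (r u x) (r u y) (r v x) (r v y) (r x y)) + #escapes u v
      ≡⟨ ∑²-+ _ _ ⟨
    ∑² d _
      ≡⟨ ∑²-cong (λ x y → pointwise x y (r x y) refl) ⟩
    ∑² d (λ x y → 2 * (P x * Q y) + 4 * ((P x + Q x) * S y))
      ≡⟨ ∑²-+ _ _ ⟩
    ∑² d (λ x y → 2 * (P x * Q y)) + ∑² d (λ x y → 4 * ((P x + Q x) * S y))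
      ≡⟨ cong₂ _+_ (trans (∑²-* 2 _) (cong (2 *_) (∑²-product P Q)))
                   (trans (∑²-* 4 _) (cong (4 *_) (trans (∑²-product _ S) (cong (_* ∑ S) (∑-+ P Q))))) ⟩
    2 * (∑ P * ∑ Q) + 4 * ((∑ P + ∑ Q) * ∑ S) ∎
    where
    open ≡-Reasoning
    P Q S : Fin d → ℕ
    P x = private-nbr₁ (r u x) (r v x)
    Q x = private-nbr₂ (r u x) (r v x)
    S x = common-non (r u x) (r v x)
    -- On the diagonal nothing is charged; the products vanish there as well, since a vertex lies in
    -- only one of the classes.
    exclusive : ∀ a b → 0 ≡ 2 * (private-nbr₁ a b * private-nbr₂ a b) +
      4 * ((private-nbr₁ a b + private-nbr₂ a b) * common-non a b)
    exclusive = toWitness {a? = ∀Rel? λ a → ∀Rel? λ b → _ ℕ.≟ _} _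
    on-same : ∀ a b → 2 * a * 0 + b * 0 + b * 0 ≡ 0
    on-same = solve-∀
    on-edge : ∀ a b → 2 * a * 1 + b * 4 + b * 0 ≡ 2 * a + 4 * b
    on-edge = solve-∀
    on-non : ∀ a b → 2 * a * 1 + b * 3 + b * 1 ≡ 2 * a + 4 * b
    on-non = solve-∀
    total : Fin d → Fin d → Rel → ℕ
    total x y xy = 2 * (P x * Q y) * distinct xy + (P x + Q x) * S y * (4 * isEdge xy + 3 * isNon xy) +
      (P x + Q x) * S y * isNon xy
    pointwise : ∀ x y xy → r x y ≡ xy → total x y (r x y) ≡ 2 * (P x * Q y) + 4 * ((P x + Q x) * S y)
    pointwise x y xy eq = trans (cong (total x y) eq) (on xy eq)
      where
      on : ∀ xy → r x y ≡ xy → total x y xy ≡ 2 * (P x * Q y) + 4 * ((P x + Q x) * S y)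
      on same eq with refl ← rel-same⁻¹ G eq =
        trans (on-same (P x * Q x) ((P x + Q x) * S x)) (exclusive (r u x) (r v x))
      on edge eq = on-edge (P x * Q y) ((P x + Q x) * S y)
      on non  eq = on-non (P x * Q y) ((P x + Q x) * S y)

  -- Kept as an identity rather than a bound: when the bound is attained, it also shows that nothing
  -- escapes.
  weight+escapes : ∀ u v → weight G u v + #escapes u v ≡
    localWeight (#private₁ u v) (#private₂ u v) (#common u v) (#nonadjacent u v)
  weight+escapes u v = begin
    4 * degree-part G u v + C + #escapes u v
      ≡⟨ ℕ.+-assoc (4 * degree-part G u v) C _ ⟩
    4 * degree-part G u v + (C + #escapes u v)
      ≡⟨ cong₂ _+_ (cong (4 *_) (degree-part≡ u v)) (charge-total u v) ⟩
    4 * (p + q + 2 * t) + (2 * (p * q) + 4 * ((p + q) * s))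
      ≡⟨ arith p q t s ⟩
    localWeight p q t s ∎
    where
    open ≡-Reasoning
    C = ∑² d λ x y → charge′ (r u x) (r u y) (r v x) (r v y) (r x y)
    p = #private₁ u v
    q = #private₂ u v
    t = #common u v
    s = #nonadjacent u v
    arith : ∀ p q t s → 4 * (p + q + 2 * t) + (2 * (p * q) + 4 * ((p + q) * s)) ≡
      4 * (p + q) + 8 * t + 2 * (p * q) + 4 * ((p + q) * s)
    arith = solve-∀

  -- The H-neighbours of `v` are sorted by their relation to `u`; the `suc` is `u` itself.
  degree₂ : ∀ {u v} → r u v ≡ non → ∑ (λ x → isNon (r v x)) ≡ suc (#private₂ u v + #common u v)
  degree₂ {u} {v} uv = begin
    ∑ (λ x → isNon (r v x))
      ≡⟨ ∑-cong (λ x → pointwise (r u x) (r v x)) ⟩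
    ∑ (λ x → isSame (r u x) * isNon (r v x) + (private-nbr₂ (r u x) (r v x) + common-nbr (r u x) (r v x)))
      ≡⟨ trans (∑-+ _ _) (cong₂ _+_ (∑-same G u (λ x → isNon (r v x))) (∑-+ _ _)) ⟩
    isNon (r v u) + (#private₂ u v + #common u v)
      ≡⟨ cong (λ z → isNon z + (#private₂ u v + #common u v)) (trans (rel-sym G v u) uv) ⟩
    suc (#private₂ u v + #common u v) ∎
    where
    open ≡-Reasoning
    pointwise : ∀ a b → isNon b ≡ isSame a * isNon b + (private-nbr₂ a b + common-nbr a b)
    pointwise = toWitness {a? = ∀Rel? λ a → ∀Rel? λ b → _ ℕ.≟ _} _

  degree₁ : ∀ {u v} → r u v ≡ non → ∑ (λ x → isNon (r u x)) ≡ suc (#private₁ u v + #common u v)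
  degree₁ {u} {v} uv = begin
    ∑ (λ x → isNon (r u x))
      ≡⟨ ∑-cong (λ x → pointwise (r u x) (r v x)) ⟩
    ∑ (λ x → isSame (r v x) * isNon (r u x) + (private-nbr₁ (r u x) (r v x) + common-nbr (r u x) (r v x)))
      ≡⟨ trans (∑-+ _ _) (cong₂ _+_ (∑-same G v (λ x → isNon (r u x))) (∑-+ _ _)) ⟩
    isNon (r u v) + (#private₁ u v + #common u v)
      ≡⟨ cong (λ z → isNon z + (#private₁ u v + #common u v)) uv ⟩
    suc (#private₁ u v + #common u v) ∎
    where
    open ≡-Reasoning
    pointwise : ∀ a b → isNon a ≡ isSame b * isNon a + (private-nbr₁ a b + common-nbr a b)
    pointwise = toWitness {a? = ∀Rel? λ a → ∀Rel? λ b → _ ℕ.≟ _} _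

-- Comparison with the complete graph

distinct-rel : ∀ {d} (G H : Graph d) i j → distinct (rel G i j) ≡ distinct (rel H i j)
distinct-rel G H i j with i ≟ j
... | yes refl rewrite rel-refl G i | rel-refl H i = refl
... | no i≢j with rel G i j in g | rel H i j in h
...   | same | _ = ⊥-elim (i≢j (rel-same⁻¹ G g))
...   | edge | same = ⊥-elim (i≢j (rel-same⁻¹ H h))
...   | non  | same = ⊥-elim (i≢j (rel-same⁻¹ H h))
...   | edge | edge = refl
...   | edge | non  = refl
...   | non  | edge = refl
...   | non  | non  = refl

distinctTriples-≡ : ∀ {d} (G H : Graph d) → distinctTriples G ≡ distinctTriples H
distinctTriples-≡ G H = ∑³-cong λ i j k →
  cong₂ _*_ (cong₂ _*_ (distinct-rel G H i j) (distinct-rel G H i k)) (distinct-rel G H j k)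

K-complete : ∀ {d} (i j : Fin d) → isNon (rel (K d) i j) ≡ 0
K-complete {d} i j with rel (K d) i j in eq
... | same = refl
... | edge = refl
... | non with i ≟ j | rel-non⁻¹ (K d) eq
...   | yes refl | _ with () ← trans (sym eq) (rel-refl (K d) i)
...   | no _ | ()

-- In `K d` there are no non-edges, so its counting identity reduces to the triples of distinct
-- vertices, a number shared with `G`.
complement-count : ∀ {d} (G : Graph d) →
  16 * ∑⁴ d (χ G) + ∑² d (λ u v → isNon (rel G u v) * (16 * others G u v)) ≡
  16 * ∑⁴ d (χ (K d)) + ∑² d (λ u v → isNon (rel G u v) * weight G u v)
complement-count {d} G = begin
  16 * ∑⁴ d (χ G) + ∑² d (λ u v → isNon (rel G u v) * (16 * others G u v))
    ≡⟨ edge-count G ⟩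
  8 * distinctTriples G + W
    ≡⟨ cong (λ z → 8 * z + W) (distinctTriples-≡ G (K d)) ⟩
  8 * distinctTriples (K d) + W
    ≡⟨ cong (_+ W) (trans (sym (ℕ.+-identityʳ _)) (cong (8 * distinctTriples (K d) +_) (sym (vanish (weight (K d)))))) ⟩
  8 * distinctTriples (K d) + ∑² d (λ u v → isNon (rel (K d) u v) * weight (K d) u v) + W
    ≡⟨ cong (_+ W) (edge-count (K d)) ⟨
  16 * ∑⁴ d (χ (K d)) + ∑² d (λ u v → isNon (rel (K d) u v) * (16 * others (K d) u v)) + W
    ≡⟨ cong (_+ W) (trans (cong (16 * ∑⁴ d (χ (K d)) +_) (vanish λ u v → 16 * others (K d) u v)) (ℕ.+-identityʳ _)) ⟩
  16 * ∑⁴ d (χ (K d)) + W ∎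
  where
  open ≡-Reasoning
  W = ∑² d (λ u v → isNon (rel G u v) * weight G u v)
  vanish : ∀ f → ∑² d (λ u v → isNon (rel (K d) u v) * f u v) ≡ 0
  vanish f = ∑-zero λ u → ∑-zero λ v → cong (_* f u v) (K-complete u v)

non-edge : ∀ {d} (G : Graph d) → ¬ IsComplete G → ∃₂ λ u v → rel G u v ≡ non
non-edge G ¬complete with Fin.any? (λ u → Fin.any? λ v → non? (rel G u v))
  where
  non? : ∀ r → Dec (r ≡ non)
  non? same = no λ ()
  non? edge = no λ ()
  non? non  = yes refl
... | yes found = found
... | no ¬found = ⊥-elim (¬complete λ i j i≢j → adjacent i j i≢j)
  where
  adjacent : ∀ i j → i ≢ j → adj G i j ≡ true
  adjacent i j i≢j with adj G i j in eq
  ... | true = refl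
  ... | false = ⊥-elim (¬found (i , j , rel-non G i≢j eq))

-- A finite check over all quadruples of sum at most 11, that is d - 2 for d ≤ 13. Both sides vanish
-- when the sum is 0, which is where 3 ≤ d enters.
localWeight-small : ∀ {p} → p < 12 → ∀ {q} → q < 12 ∸ p → ∀ {t} → t < 12 ∸ (p + q) → ∀ {s} → s < 12 ∸ (p + q + t) →
  1 ≤ p + q + t + s → localWeight p q t s < 16 * (p + q + t + s)
localWeight-small = toWitness {a? =
  ℕ.allUpTo? (λ p → ℕ.allUpTo? (λ q → ℕ.allUpTo? (λ t → ℕ.allUpTo? (λ s →
    (1 ℕ.≤? p + q + t + s) →-dec (localWeight p q t s ℕ.<? 16 * (p + q + t + s)))
    (12 ∸ (p + q + t))) (12 ∸ (p + q))) (12 ∸ p)) 12} _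

Extremal : ℕ → ℕ → ℕ → ℕ → Set
Extremal p q t s = t ≡ 0 ×
  ((p ≡ 3 × q ≡ 4 × s ≡ 5) ⊎ (p ≡ 4 × q ≡ 3 × s ≡ 5) ⊎ (p ≡ 4 × q ≡ 4 × s ≡ 4))

-- Here 12 is 14 - 2 and 192 is `16 * 12`. As `s` is determined by the other three numbers, only
-- these are enumerated.
localWeight-twelve : ∀ {p} → p < 13 → ∀ {q} → q < 13 ∸ p → ∀ {t} → t < 13 ∸ (p + q) →
  let s = 12 ∸ (p + q + t) in
  localWeight p q t s ≤ 192 × (localWeight p q t s ≡ 192 → Extremal p q t s)
localWeight-twelve = toWitness {a? =
  ℕ.allUpTo? (λ p → ℕ.allUpTo? (λ q → ℕ.allUpTo? (λ t →
    let s = 12 ∸ (p + q + t) in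
    (localWeight p q t s ℕ.≤? 192) ×-dec ((localWeight p q t s ℕ.≟ 192) →-dec
    ((t ℕ.≟ 0) ×-dec (((p ℕ.≟ 3) ×-dec (q ℕ.≟ 4) ×-dec (s ℕ.≟ 5)) ⊎-dec
      (((p ℕ.≟ 4) ×-dec (q ℕ.≟ 3) ×-dec (s ℕ.≟ 5)) ⊎-dec ((p ℕ.≟ 4) ×-dec (q ℕ.≟ 4) ×-dec (s ℕ.≟ 4)))))))
    (13 ∸ (p + q))) (13 ∸ p)) 13} _

localWeight-< : ∀ p q t s → 1 ≤ p + q + t + s → p + q + t + s ≤ 11 →
  localWeight p q t s < 16 * (p + q + t + s)
localWeight-< p q t s ge le = localWeight-small p<12
  (ℕ.m+n≤o⇒m≤o∸n (suc q) (subst (λ z → suc z ≤ 12) (ℕ.+-comm p q) pq))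
  (ℕ.m+n≤o⇒m≤o∸n (suc t) (subst (λ z → suc z ≤ 12) (ℕ.+-comm (p + q) t) pqt))
  (ℕ.m+n≤o⇒m≤o∸n (suc s) (subst (λ z → suc z ≤ 12) (ℕ.+-comm (p + q + t) s) (s≤s le)))
  ge
  where
  pqt : suc (p + q + t) ≤ 12
  pqt = s≤s (ℕ.≤-trans (ℕ.m≤m+n (p + q + t) s) le)
  pq : suc (p + q) ≤ 12
  pq = ℕ.≤-trans (s≤s (ℕ.m≤m+n (p + q) t)) pqt
  p<12 : suc p ≤ 12
  p<12 = ℕ.≤-trans (s≤s (ℕ.m≤m+n p q)) pq

localWeight-≤ : ∀ p q t s → p + q + t + s ≡ 12 →
  localWeight p q t s ≤ 192 × (localWeight p q t s ≡ 192 → Extremal p q t s)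
localWeight-≤ p q t s eq = subst
  (λ s → localWeight p q t s ≤ 192 × (localWeight p q t s ≡ 192 → Extremal p q t s)) s≡
  (localWeight-twelve p<13
    (ℕ.m+n≤o⇒m≤o∸n (suc q) (subst (λ z → suc z ≤ 13) (ℕ.+-comm p q) pq))
    (ℕ.m+n≤o⇒m≤o∸n (suc t) (subst (λ z → suc z ≤ 13) (ℕ.+-comm (p + q) t) pqt)))
  where
  s≡ : 12 ∸ (p + q + t) ≡ s
  s≡ = trans (cong (_∸ (p + q + t)) (sym eq)) (ℕ.m+n∸m≡n (p + q + t) s)
  pqt : suc (p + q + t) ≤ 13
  pqt = s≤s (ℕ.≤-trans (ℕ.m≤m+n (p + q + t) s) (ℕ.≤-reflexive eq))
  pq : suc (p + q) ≤ 13
  pq = ℕ.≤-trans (s≤s (ℕ.m≤m+n (p + q) t)) pqt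
  p<13 : suc p ≤ 13
  p<13 = ℕ.≤-trans (s≤s (ℕ.m≤m+n p q)) pq

isNon-mono : ∀ r {a b} → (r ≡ non → a ≤ b) → isNon r * a ≤ isNon r * b
isNon-mono same le = z≤n
isNon-mono edge le = z≤n
isNon-mono non  le = ℕ.*-monoʳ-≤ 1 (le refl)

isNon-mono-< : ∀ {r a b} → r ≡ non → a < b → isNon r * a < isNon r * b
isNon-mono-< refl lt = ℕ.*-monoʳ-< 1 lt

module _ {d} (G : Graph d) where

  private
    r : Fin d → Fin d → Rel
    r = rel G
    n m : ℕ
    n = ∑⁴ d (χ G)
    m = ∑⁴ d (χ (K d))

  non-≢ : ∀ {u v} → r u v ≡ non → u ≢ v
  non-≢ uv = rel-≢ G uv λ ()

  budget load : ℕ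
  budget = ∑² d λ u v → isNon (r u v) * (16 * others G u v)
  load   = ∑² d λ u v → isNon (r u v) * weight G u v

  private
    balance : 16 * n + budget ≡ 16 * m + load
    balance = complement-count G

  load<budget : load < budget → n < m
  load<budget lt = ℕ.*-cancelˡ-< 16 n m (ℕ.+-cancelʳ-< budget (16 * n) (16 * m)
    (subst (_< 16 * m + budget) (sym balance) (ℕ.+-monoʳ-< (16 * m) lt)))

  budget<load : budget < load → m < n
  budget<load lt = ℕ.*-cancelˡ-< 16 m n (ℕ.+-cancelʳ-< load (16 * m) (16 * n)
    (subst (_< 16 * n + load) balance (ℕ.+-monoʳ-< (16 * n) lt)))

  load≡budget : load ≡ budget → n ≡ m
  load≡budget eq = ℕ.*-cancelˡ-≡ n m 16 (ℕ.+-cancelʳ-≡ budget (16 * n) (16 * m)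
    (trans balance (cong (16 * m +_) eq)))

  load≤budget : load ≤ budget → n ≤ m
  load≤budget le with ℕ.m≤n⇒m<n∨m≡n le
  ... | inj₁ lt = ℕ.<⇒≤ (load<budget lt)
  ... | inj₂ eq = ℕ.≤-reflexive (load≡budget eq)

  ∑-nonedges-< : ∀ {f g : Fin d → Fin d → ℕ} → (∀ {u v} → r u v ≡ non → f u v ≤ g u v) →
    ∀ {u v} → r u v ≡ non → f u v < g u v →
    ∑² d (λ u v → isNon (r u v) * f u v) < ∑² d (λ u v → isNon (r u v) * g u v)
  ∑-nonedges-< {f} {g} le {u} {v} uv lt =
    ∑-mono-< (λ a → ∑-mono (le′ a)) u (∑-mono-< (le′ u) v (isNon-mono-< uv lt))
    where
    le′ : ∀ a b → isNon (r a b) * f a b ≤ isNon (r a b) * g a b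
    le′ a b = isNon-mono (r a b) le

  fewer-edges : ¬ IsComplete G → (∀ {u v} → r u v ≡ non → weight G u v < 16 * others G u v) → n < m
  fewer-edges ¬complete light with _ , _ , uv ← non-edge G ¬complete =
    load<budget (∑-nonedges-< (ℕ.<⇒≤ ∘ light) uv (light uv))

  more-edges : ¬ IsComplete G → (∀ {u v} → r u v ≡ non → 16 * others G u v < weight G u v) → m < n
  more-edges ¬complete heavy with _ , _ , uv ← non-edge G ¬complete =
    budget<load (∑-nonedges-< (ℕ.<⇒≤ ∘ heavy) uv (heavy uv))

  equally-many-edges : (∀ {u v} → r u v ≡ non → weight G u v ≡ 16 * others G u v) → n ≡ m
  equally-many-edges tight = load≡budget (ℕ.≤-antisym
    (∑-mono λ u → ∑-mono λ v → isNon-mono (r u v) (ℕ.≤-reflexive ∘ tight))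
    (∑-mono λ u → ∑-mono λ v → isNon-mono (r u v) (ℕ.≤-reflexive ∘ sym ∘ tight)))

  at-most-as-many-edges : (∀ {u v} → r u v ≡ non → weight G u v ≤ 16 * others G u v) → n ≤ m
  at-most-as-many-edges le = load≤budget (∑-mono λ u → ∑-mono λ v → isNon-mono (r u v) le)

  -- By the balance, 16 (m - n) is the sum over the edges of H of `16 * others` minus `weight`. No
  -- term is negative, so a vanishing sum leaves no room at any edge.
  equality-tight : (∀ {u v} → r u v ≡ non → weight G u v ≤ 16 * others G u v) → n ≡ m →
    ∀ {u v} → r u v ≡ non → weight G u v ≡ 16 * others G u v
  equality-tight le n≡m {u} {v} uv with ℕ.m≤n⇒m<n∨m≡n (le uv)
  ... | inj₂ eq = eq
  ... | inj₁ lt = ⊥-elim (ℕ.<-irrefl n≡m (load<budget (∑-nonedges-< le uv lt)))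

  weight≤ : ∀ u v → weight G u v ≤ localWeight (#private₁ G u v) (#private₂ G u v) (#common G u v) (#nonadjacent G u v)
  weight≤ u v = ℕ.≤-trans (ℕ.m≤m+n _ (#escapes G u v)) (ℕ.≤-reflexive (weight+escapes G u v))

  light-small : 3 ≤ d → d ≤ 13 → ∀ {u v} → r u v ≡ non → weight G u v < 16 * others G u v
  light-small 3≤d d≤13 {u} {v} uv = ℕ.≤-<-trans (weight≤ u v)
    (subst (λ z → localWeight p q t s < 16 * z) (sym (others≡ G u v))
      (localWeight-< p q t s
        (subst (1 ≤_) (others≡ G u v) (ℕ.+-cancelʳ-≤ 2 1 _ (subst (3 ≤_) (sym (others+2 G (non-≢ uv))) 3≤d)))
        (subst (_≤ 11) (others≡ G u v) (ℕ.+-cancelʳ-≤ 2 _ 11 (subst (_≤ 13) (sym (others+2 G (non-≢ uv))) d≤13)))))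
    where
    p = #private₁ G u v
    q = #private₂ G u v
    t = #common G u v
    s = #nonadjacent G u v

-- Structure of the complement when every one of its edges is tight

module _ {d} (G : Graph d)
  (tight : ∀ {u v} → rel G u v ≡ non →
    Extremal (#private₁ G u v) (#private₂ G u v) (#common G u v) (#nonadjacent G u v) × #escapes G u v ≡ 0)
  where

  private
    r : Fin d → Fin d → Rel
    r = rel G

    flip : ∀ {x y s} → r x y ≡ s → r y x ≡ s
    flip {x} {y} xy = trans (rel-sym G y x) xy

    clash : ∀ {A : Set} {x y} → r x y ≡ edge → r x y ≡ non → A
    clash e n with () ← trans (sym e) n

  triangle-free : ∀ {u v x} → r u v ≡ non → r u x ≡ non → r v x ≡ non → ⊥
  triangle-free {u} {v} {x} uv ux vx = ℕ.1+n≰n (begin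
    1                              ≡⟨ cong₂ (λ a b → common-nbr a b) ux vx ⟨
    common-nbr (r u x) (r v x)     ≤⟨ ∑-term (λ x → common-nbr (r u x) (r v x)) x ⟩
    #common G u v                  ≡⟨ proj₁ (proj₁ (tight uv)) ⟩
    0                              ∎)
    where open ℕ.≤-Reasoning

  -- Such `v`, `u`, `x`, `y` form an induced P₄ of H with end edge uv, which `#escapes` would count.
  no-escape₁ : ∀ {u v x y} → r u v ≡ non → r u x ≡ non → r v x ≡ edge →
    r u y ≡ edge → r v y ≡ edge → r x y ≡ non → ⊥
  no-escape₁ {u} {v} {x} {y} uv ux vx uy vy xy = ℕ.1+n≰n (begin
    1                 ≡⟨ one ⟨
    escape x y        ≤⟨ ∑-term (escape x) y ⟩
    ∑ (escape x)      ≤⟨ ∑-term (λ x → ∑ (escape x)) x ⟩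
    #escapes G u v    ≡⟨ proj₂ (tight uv) ⟩
    0                 ∎)
    where
    open ℕ.≤-Reasoning
    escape : Fin d → Fin d → ℕ
    escape x y = (private-nbr₁ (r u x) (r v x) + private-nbr₂ (r u x) (r v x)) *
      common-non (r u y) (r v y) * isNon (r x y)
    one : escape x y ≡ 1
    one rewrite ux | vx | uy | vy | xy = refl

  no-escape₂ : ∀ {u v x y} → r u v ≡ non → r u x ≡ edge → r v x ≡ non →
    r u y ≡ edge → r v y ≡ edge → r x y ≡ non → ⊥
  no-escape₂ uv ux vx uy vy xy = no-escape₁ (flip uv) vx ux vy uy xy

  module _ {u v} (uv : r u v ≡ non) where

    -- Otherwise `j`, `u`, `v`, `i` would be an induced P₄ of H; a further H-adjacency among them
    -- would close a triangle, and `i` may be `u` or `j` be `v`.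
    complete-between : ∀ {i j} → r v i ≡ non → r u j ≡ non → r i j ≡ non
    complete-between {i} {j} vi uj with r u i in ui | r v j in vj | r i j in ij
    ... | _    | _    | non  = refl
    ... | same | _    | _    with refl ← rel-same⁻¹ G ui = trans (sym ij) uj
    ... | non  | _    | _    = ⊥-elim (triangle-free uv ui vi)
    ... | edge | same | _    with refl ← rel-same⁻¹ G vj = trans (sym ij) (flip vi)
    ... | edge | non  | _    = ⊥-elim (triangle-free uv uj vj)
    ... | edge | edge | same with refl ← rel-same⁻¹ G ij = clash ui uj
    ... | edge | edge | edge = ⊥-elim (no-escape₁ uj uv (flip vj) ui (flip ij) vi)

    -- Otherwise H has the induced P₄ `u`, `v`, `i`, `j`, or a triangle. Thus the H-neighbourhoods
    -- of `u` and `v` together make up the component of uv.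
    closed : ∀ {i j} → r i j ≡ non → r v i ≡ non → r u j ≡ non
    closed {i} {j} ij vi with r u i in ui | r u j in uj | r v j in vj
    ... | _    | non  | _    = refl
    ... | same | _    | _    with refl ← rel-same⁻¹ G ui = trans (sym uj) ij
    ... | non  | _    | _    = ⊥-elim (triangle-free uv ui vi)
    ... | edge | same | _    with refl ← rel-same⁻¹ G uj = clash ui (flip ij)
    ... | edge | edge | non  = ⊥-elim (triangle-free vi vj ij)
    ... | edge | edge | same with refl ← rel-same⁻¹ G vj = clash uj uv
    ... | edge | edge | edge = ⊥-elim (no-escape₂ uv ui vi uj vj ij)

  module _ {u v} (uv : r u v ≡ non) where

    -- The contrapositive of `closed`, applied at both ends of uv.
    outside : ∀ {i x} → r u i ≡ edge → r v i ≡ edge → r i x ≡ non → r u x ≡ edge × r v x ≡ edge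
    outside {i} {x} ui vi ix with r u x in ux | r v x in vx
    ... | edge | edge = refl , refl
    ... | same | _    with refl ← rel-same⁻¹ G ux = clash ui (flip ix)
    ... | non  | _    = clash vi (closed (flip uv) (flip ix) ux)
    ... | edge | same with refl ← rel-same⁻¹ G vx = clash vi (flip ix)
    ... | edge | non  = clash ui (closed uv (flip ix) vx)

    -- A second component contains an edge ij with p + q ≥ 7. These private neighbours of ij all lie
    -- among the vertices adjacent in H to neither `u` nor `v`, of which there are s ≤ 5.
    one-component : ∀ {i j} → r i j ≡ non →
      r u i ≡ edge → r v i ≡ edge → r u j ≡ edge → r v j ≡ edge → ⊥
    one-component {i} {j} ij ui vi uj vj = 7≰5 (ℕ.≤-trans (large (proj₁ (tight ij)))
      (ℕ.≤-trans (subst (_≤ #nonadjacent G u v) (∑-+ _ _) (∑-mono inside)) (small (proj₁ (tight uv)))))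
      where
      7≰5 : ¬ 7 ≤ 5
      7≰5 (s≤s (s≤s (s≤s (s≤s (s≤s ())))))
      large : ∀ {p q t s} → Extremal p q t s → 7 ≤ p + q
      large (_ , inj₁ (refl , refl , _)) = ℕ.≤-refl
      large (_ , inj₂ (inj₁ (refl , refl , _))) = ℕ.≤-refl
      large (_ , inj₂ (inj₂ (refl , refl , _))) = ℕ.n≤1+n 7
      small : ∀ {p q t s} → Extremal p q t s → s ≤ 5
      small (_ , inj₁ (_ , _ , refl)) = ℕ.≤-refl
      small (_ , inj₂ (inj₁ (_ , _ , refl))) = ℕ.≤-refl
      small (_ , inj₂ (inj₂ (_ , _ , refl))) = ℕ.n≤1+n 4
      inside : ∀ x → private-nbr₁ (r i x) (r j x) + private-nbr₂ (r i x) (r j x) ≤ common-non (r u x) (r v x)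
      inside x with r i x in ix | r j x in jx
      ... | same | same = z≤n
      ... | same | edge = z≤n
      ... | same | non  = z≤n
      ... | edge | same = z≤n
      ... | edge | edge = z≤n
      ... | non  | same = z≤n
      ... | non  | non  = z≤n
      ... | non  | edge = ℕ.≤-reflexive (sym (cong₂ common-non (proj₁ o) (proj₂ o)))
        where o = outside ui vi ix
      ... | edge | non  = ℕ.≤-reflexive (sym (cong₂ common-non (proj₁ o) (proj₂ o)))
        where o = outside uj vj jx

    dichotomy : ∀ {i j} → r i j ≡ non → (r v i ≡ non × r u j ≡ non) ⊎ (r u i ≡ non × r v j ≡ non)
    dichotomy {i} {j} ij with r v i in vi | r u i in ui | r v j in vj | r u j in uj
    ... | non  | _    | _    | _    = inj₁ (refl , trans (sym uj) (closed uv ij vi))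
    ... | _    | non  | _    | _    = inj₂ (refl , trans (sym vj) (closed (flip uv) ij ui))
    ... | _    | _    | non  | _    = inj₂ (trans (sym ui) (closed uv (flip ij) vj) , refl)
    ... | _    | _    | _    | non  = inj₁ (trans (sym vi) (closed (flip uv) (flip ij) uj) , refl)
    ... | same | _    | _    | _    with refl ← rel-same⁻¹ G vi = inj₂ (trans (sym ui) uv , trans (sym vj) ij)
    ... | _    | same | _    | _    with refl ← rel-same⁻¹ G ui = inj₁ (trans (sym vi) (flip uv) , trans (sym uj) ij)
    ... | _    | _    | same | _    with refl ← rel-same⁻¹ G vj = inj₁ (trans (sym vi) (flip ij) , trans (sym uj) uv)
    ... | _    | _    | _    | same with refl ← rel-same⁻¹ G uj = inj₂ (trans (sym ui) (flip ij) , trans (sym vj) (flip uv))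
    ... | edge | edge | edge | edge = ⊥-elim (one-component ij ui vi uj vj)

-- Complements of the form K_{p,q}

isNonᵇ : Rel → Bool
isNonᵇ same = false
isNonᵇ edge = false
isNonᵇ non  = true

toℕᵇ : Bool → ℕ
toℕᵇ false = 0
toℕᵇ true  = 1

toℕᵇ-isNonᵇ : ∀ r → toℕᵇ (isNonᵇ r) ≡ isNon r
toℕᵇ-isNonᵇ same = refl
toℕᵇ-isNonᵇ edge = refl
toℕᵇ-isNonᵇ non  = refl

∣_∣≡∑ : ∀ {d} (A : Subset d) → ∣ A ∣ ≡ ∑ (λ x → toℕᵇ (lookup A x))
∣ [] ∣≡∑ = sym (∑-nil _)
∣ false ∷ A ∣≡∑ = trans ∣ A ∣≡∑ (sym (∑-suc _))
∣ true  ∷ A ∣≡∑ = trans (cong suc ∣ A ∣≡∑) (sym (∑-suc _))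

module _ {d} (G : Graph d) where

  private
    r : Fin d → Fin d → Rel
    r = rel G

  nonNeighbours : Fin d → Subset d
  nonNeighbours u = tabulate λ x → isNonᵇ (r u x)

  ∈-nonNeighbours⁺ : ∀ {u x} → r u x ≡ non → x ∈ nonNeighbours u
  ∈-nonNeighbours⁺ {u} {x} ux = lookup⇒[]= x _ (trans (lookup∘tabulate _ x) (cong isNonᵇ ux))

  ∈-nonNeighbours⁻ : ∀ {u x} → x ∈ nonNeighbours u → r u x ≡ non
  ∈-nonNeighbours⁻ {u} {x} x∈ = isNonᵇ⁻¹ (r u x) (trans (sym (lookup∘tabulate _ x)) ([]=⇒lookup x∈))
    where
    isNonᵇ⁻¹ : ∀ r → isNonᵇ r ≡ true → r ≡ non
    isNonᵇ⁻¹ non _ = refl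

  ∣nonNeighbours∣ : ∀ u → ∣ nonNeighbours u ∣ ≡ ∑ (λ x → isNon (r u x))
  ∣nonNeighbours∣ u = trans ∣ nonNeighbours u ∣≡∑
    (∑-cong λ x → trans (cong toℕᵇ (lookup∘tabulate _ x)) (toℕᵇ-isNonᵇ (r u x)))

module _ {d} (G : Graph d)
  (tight : ∀ {u v} → rel G u v ≡ non →
    Extremal (#private₁ G u v) (#private₂ G u v) (#common G u v) (#nonadjacent G u v) × #escapes G u v ≡ 0)
  where

  -- The sides are the H-neighbourhoods of `v` and of `u`. The first contains `u` and the private
  -- neighbours of `v`, the second `v` and those of `u`, which explains the `suc` and the order of
  -- the sizes.
  tight⇒Kpq : ∀ {u v} → rel G u v ≡ non →
    ComplementIsKpq G (suc (#private₂ G u v)) (suc (#private₁ G u v))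
  tight⇒Kpq {u} {v} uv = nonNeighbours G v , nonNeighbours G u ,
    size (degree₂ G uv) , size (degree₁ G uv) ,
    (λ x x∈A x∈B → triangle-free G tight uv (∈-nonNeighbours⁻ G x∈B) (∈-nonNeighbours⁻ G x∈A)) ,
    λ i j i≢j → (λ ij → into (dichotomy G tight uv (rel-non G i≢j ij))) , rel-non⁻¹ G ∘ from
    where
    t≡0 : #common G u v ≡ 0
    t≡0 = proj₁ (proj₁ (tight uv))
    size : ∀ {w p} → ∑ (λ x → isNon (rel G w x)) ≡ suc (p + #common G u v) → ∣ nonNeighbours G w ∣ ≡ suc p
    size {w} {p} eq = trans (∣nonNeighbours∣ G w)
      (trans eq (cong suc (trans (cong (p +_) t≡0) (ℕ.+-identityʳ p))))
    into : ∀ {i j} → (rel G v i ≡ non × rel G u j ≡ non) ⊎ (rel G u i ≡ non × rel G v j ≡ non) →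
      (i ∈ nonNeighbours G v × j ∈ nonNeighbours G u) ⊎ (i ∈ nonNeighbours G u × j ∈ nonNeighbours G v)
    into (inj₁ (a , b)) = inj₁ (∈-nonNeighbours⁺ G a , ∈-nonNeighbours⁺ G b)
    into (inj₂ (a , b)) = inj₂ (∈-nonNeighbours⁺ G a , ∈-nonNeighbours⁺ G b)
    from : ∀ {i j} →
      (i ∈ nonNeighbours G v × j ∈ nonNeighbours G u) ⊎ (i ∈ nonNeighbours G u × j ∈ nonNeighbours G v) →
      rel G i j ≡ non
    from (inj₁ (a , b)) = complete-between G tight uv (∈-nonNeighbours⁻ G a) (∈-nonNeighbours⁻ G b)
    from {i} {j} (inj₂ (a , b)) = trans (rel-sym G i j)
      (complete-between G tight uv (∈-nonNeighbours⁻ G b) (∈-nonNeighbours⁻ G a))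

  tight⇒K₄₅⊎K₅₅ : ¬ IsComplete G → ComplementIsKpq G 4 5 ⊎ ComplementIsKpq G 5 5
  tight⇒K₄₅⊎K₅₅ ¬complete with u , v , uv ← non-edge G ¬complete = on (proj₁ (tight uv))
    where
    swapSides : ∀ {p q} → ComplementIsKpq G p q → ComplementIsKpq G q p
    swapSides (A , B , a , b , disj , edges) = B , A , b , a , (λ i i∈B i∈A → disj i i∈A i∈B) ,
      λ i j i≢j → swap ∘ proj₁ (edges i j i≢j) , proj₂ (edges i j i≢j) ∘ swap
    Kqp : ∀ {p q} → #private₁ G u v ≡ p → #private₂ G u v ≡ q → ComplementIsKpq G (suc q) (suc p)
    Kqp eq₁ eq₂ = subst₂ (λ p q → ComplementIsKpq G (suc q) (suc p)) eq₁ eq₂ (tight⇒Kpq uv)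
    on : Extremal (#private₁ G u v) (#private₂ G u v) (#common G u v) (#nonadjacent G u v) →
      ComplementIsKpq G 4 5 ⊎ ComplementIsKpq G 5 5
    on (_ , inj₁ (p , q , _)) = inj₁ (swapSides (Kqp p q))
    on (_ , inj₂ (inj₁ (p , q , _))) = inj₁ (Kqp p q)
    on (_ , inj₂ (inj₂ (p , q , _))) = inj₂ (Kqp p q)

-- Weights when the complement is complete bipartite

module _ {d} (G : Graph d) {a b} (Kab : ComplementIsKpq G a b) where

  private
    r : Fin d → Fin d → Rel
    r = rel G
    A B : Subset d
    A = proj₁ Kab
    B = proj₁ (proj₂ Kab)
    ∣A∣ : ∣ A ∣ ≡ a
    ∣A∣ = proj₁ (proj₂ (proj₂ Kab))
    ∣B∣ : ∣ B ∣ ≡ b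
    ∣B∣ = proj₁ (proj₂ (proj₂ (proj₂ Kab)))
    disjoint : ∀ {x} → x ∈ A → x ∉ B
    disjoint = proj₁ (proj₂ (proj₂ (proj₂ (proj₂ Kab)))) _

    sides : ∀ {x y} → r x y ≡ non → (x ∈ A × y ∈ B) ⊎ (x ∈ B × y ∈ A)
    sides {x} {y} xy = proj₁ (proj₂ (proj₂ (proj₂ (proj₂ (proj₂ Kab)))) x y (rel-≢ G xy λ ())) (rel-non⁻¹ G xy)

    across : ∀ {x y} → (x ∈ A × y ∈ B) ⊎ (x ∈ B × y ∈ A) → r x y ≡ non
    across {x} {y} p = rel-non G (x≢y p) (proj₂ (proj₂ (proj₂ (proj₂ (proj₂ (proj₂ Kab)))) x y (x≢y p)) p)
      where
      x≢y : (x ∈ A × y ∈ B) ⊎ (x ∈ B × y ∈ A) → x ≢ y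
      x≢y (inj₁ (x∈A , x∈B)) refl = disjoint x∈A x∈B
      x≢y (inj₂ (x∈B , x∈A)) refl = disjoint x∈A x∈B

    fromA : ∀ {x y} → x ∈ A → r x y ≡ non → y ∈ B
    fromA x∈A xy with sides xy
    ... | inj₁ (_ , y∈B) = y∈B
    ... | inj₂ (x∈B , _) = ⊥-elim (disjoint x∈A x∈B)

    fromB : ∀ {x y} → x ∈ B → r x y ≡ non → y ∈ A
    fromB x∈B xy with sides xy
    ... | inj₁ (x∈A , _) = ⊥-elim (disjoint x∈A x∈B)
    ... | inj₂ (_ , y∈A) = y∈A

    degree : ∀ {u} (C : Subset d) → (∀ {x} → r u x ≡ non → x ∈ C) → (∀ {x} → x ∈ C → r u x ≡ non) →
      ∑ (λ x → isNon (r u x)) ≡ ∣ C ∣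
    degree {u} C to from = trans (∑-cong pointwise) (sym ∣ C ∣≡∑)
      where
      pointwise : ∀ x → isNon (r u x) ≡ toℕᵇ (lookup C x)
      pointwise x with lookup C x in eq
      ... | true = cong isNon (from (lookup⇒[]= x C eq))
      ... | false with r u x in ux
      ...   | same = refl
      ...   | edge = refl
      ...   | non with () ← trans (sym eq) ([]=⇒lookup (to ux))

    degreeA : ∀ {u} → u ∈ A → ∑ (λ x → isNon (r u x)) ≡ b
    degreeA u∈A = trans (degree B (fromA u∈A) (λ x∈B → across (inj₁ (u∈A , x∈B)))) ∣B∣

    degreeB : ∀ {u} → u ∈ B → ∑ (λ x → isNon (r u x)) ≡ a
    degreeB u∈B = trans (degree A (fromB u∈B) (λ x∈A → across (inj₂ (u∈B , x∈A)))) ∣A∣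

    bipartite : ∀ {u v x} → r u v ≡ non → r u x ≡ non → r v x ≡ non → ⊥
    bipartite uv ux vx with sides uv
    ... | inj₁ (u∈A , v∈B) = disjoint (fromB v∈B vx) (fromA u∈A ux)
    ... | inj₂ (u∈B , v∈A) = disjoint (fromB u∈B ux) (fromA v∈A vx)

    -- The ends of a path on four vertices lie on opposite sides, so no P₄ is induced and nothing
    -- escapes.
    three-path : ∀ {u v x y} → r u v ≡ non → r u x ≡ non → r x y ≡ non → r v y ≡ non
    three-path uv ux xy with sides uv
    ... | inj₁ (u∈A , v∈B) = across (inj₂ (v∈B , fromB (fromA u∈A ux) xy))
    ... | inj₂ (u∈B , v∈A) = across (inj₁ (v∈A , fromA (fromB u∈B ux) xy))

  Kpq-common : ∀ {u v} → r u v ≡ non → #common G u v ≡ 0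
  Kpq-common {u} {v} uv = ∑-zero λ x → on x (r u x) (r v x) refl refl
    where
    on : ∀ x s t → r u x ≡ s → r v x ≡ t → common-nbr s t ≡ 0
    on x non  non  ux vx = ⊥-elim (bipartite uv ux vx)
    on x non  same _ _ = refl
    on x non  edge _ _ = refl
    on x same _    _ _ = refl
    on x edge _    _ _ = refl

  Kpq-escapes : ∀ {u v} → r u v ≡ non → #escapes G u v ≡ 0
  Kpq-escapes {u} {v} uv = ∑-zero λ x → ∑-zero λ y →
    on (r u x) (r v x) (r u y) (r v y) (r x y) refl refl refl refl refl
    where
    vu : r v u ≡ non
    vu = trans (rel-sym G v u) uv
    on : ∀ {x y} ux vx uy vy xy → r u x ≡ ux → r v x ≡ vx → r u y ≡ uy → r v y ≡ vy → r x y ≡ xy →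
      (private-nbr₁ ux vx + private-nbr₂ ux vx) * common-non uy vy * isNon xy ≡ 0
    on ux vx uy vy same _ _ _ _ _ = ℕ.*-zeroʳ ((private-nbr₁ ux vx + private-nbr₂ ux vx) * common-non uy vy)
    on ux vx uy vy edge _ _ _ _ _ = ℕ.*-zeroʳ ((private-nbr₁ ux vx + private-nbr₂ ux vx) * common-non uy vy)
    on ux vx same vy non _ _ _ _ _ = cong (_* 1) (ℕ.*-zeroʳ (private-nbr₁ ux vx + private-nbr₂ ux vx))
    on ux vx non vy non _ _ _ _ _ = cong (_* 1) (ℕ.*-zeroʳ (private-nbr₁ ux vx + private-nbr₂ ux vx))
    on ux vx edge same non _ _ _ _ _ = cong (_* 1) (ℕ.*-zeroʳ (private-nbr₁ ux vx + private-nbr₂ ux vx))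
    on ux vx edge non non _ _ _ _ _ = cong (_* 1) (ℕ.*-zeroʳ (private-nbr₁ ux vx + private-nbr₂ ux vx))
    on same same edge edge non _ _ _ _ _ = refl
    on same edge edge edge non _ _ _ _ _ = refl
    on same non  edge edge non _ _ _ _ _ = refl
    on edge same edge edge non _ _ _ _ _ = refl
    on edge edge edge edge non _ _ _ _ _ = refl
    on non  same edge edge non _ _ _ _ _ = refl
    on non  non  edge edge non _ _ _ _ _ = refl
    on non  edge edge edge non ux _ _ vy xy with () ← trans (sym vy) (three-path uv ux xy)
    on edge non  edge edge non _ vx uy _ xy with () ← trans (sym uy) (three-path vu vx xy)

  private
    drop-common : ∀ {u v p n k} → rel G u v ≡ non → n ≡ suc (p + #common G u v) → n ≡ k → suc p ≡ k
    drop-common {p = p} uv eq eq′ = trans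
      (cong suc (sym (trans (cong (p +_) (Kpq-common uv)) (ℕ.+-identityʳ p)))) (trans (sym eq) eq′)

  Kpq-private : ∀ {u v} → r u v ≡ non →
    (suc (#private₁ G u v) ≡ b × suc (#private₂ G u v) ≡ a) ⊎
    (suc (#private₁ G u v) ≡ a × suc (#private₂ G u v) ≡ b)
  Kpq-private {u} {v} uv with sides uv
  ... | inj₁ (u∈A , v∈B) = inj₁
    (drop-common uv (degree₁ G uv) (degreeA u∈A) , drop-common uv (degree₂ G uv) (degreeB v∈B))
  ... | inj₂ (u∈B , v∈A) = inj₂
    (drop-common uv (degree₁ G uv) (degreeB u∈B) , drop-common uv (degree₂ G uv) (degreeA v∈A))

  Kpq-weight : ∀ {u v} → r u v ≡ non →
    weight G u v ≡ localWeight (#private₁ G u v) (#private₂ G u v) 0 (#nonadjacent G u v)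
  Kpq-weight {u} {v} uv = begin
    weight G u v                    ≡⟨ ℕ.+-identityʳ _ ⟨
    weight G u v + 0                ≡⟨ cong (weight G u v +_) (Kpq-escapes uv) ⟨
    weight G u v + #escapes G u v   ≡⟨ weight+escapes G u v ⟩
    localWeight (#private₁ G u v) (#private₂ G u v) (#common G u v) (#nonadjacent G u v)
      ≡⟨ cong (λ t → localWeight (#private₁ G u v) (#private₂ G u v) t (#nonadjacent G u v)) (Kpq-common uv) ⟩
    localWeight (#private₁ G u v) (#private₂ G u v) 0 (#nonadjacent G u v) ∎
    where open ≡-Reasoning

  Kpq-others : ∀ {u v} → r u v ≡ non →
    others G u v ≡ #private₁ G u v + #private₂ G u v + #nonadjacent G u v
  Kpq-others {u} {v} uv = trans (others≡ G u v) (cong (_+ #nonadjacent G u v)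
    (trans (cong (#private₁ G u v + #private₂ G u v +_) (Kpq-common uv)) (ℕ.+-identityʳ _)))

-- Fourteen vertices

module _ (G : Graph 14) where

  private
    r : Fin 14 → Fin 14 → Rel
    r = rel G

    others≡12 : ∀ {u v} → r u v ≡ non → others G u v ≡ 12
    others≡12 uv = ℕ.+-cancelʳ-≡ 2 _ 12 (others+2 G (non-≢ G uv))

    p q t s : Fin 14 → Fin 14 → ℕ
    p = #private₁ G
    q = #private₂ G
    t = #common G
    s = #nonadjacent G

    local : ∀ {u v} → r u v ≡ non → localWeight (p u v) (q u v) (t u v) (s u v) ≤ 192 ×
      (localWeight (p u v) (q u v) (t u v) (s u v) ≡ 192 → Extremal (p u v) (q u v) (t u v) (s u v))
    local {u} {v} uv = localWeight-≤ (p u v) (q u v) (t u v) (s u v) (trans (sym (others≡ G u v)) (others≡12 uv))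

  weight₁₄ : ∀ {u v} → r u v ≡ non → weight G u v ≤ 16 * others G u v
  weight₁₄ {u} {v} uv = subst (λ z → weight G u v ≤ 16 * z) (sym (others≡12 uv))
    (ℕ.≤-trans (weight≤ G u v) (proj₁ (local uv)))

  -- The chain 192 = weight ≤ weight + escapes = `localWeight` ≤ 192 collapses, which gives both
  -- conclusions.
  tight₁₄ : ∀ {u v} → r u v ≡ non → weight G u v ≡ 16 * others G u v →
    Extremal (p u v) (q u v) (t u v) (s u v) × #escapes G u v ≡ 0
  tight₁₄ {u} {v} uv eq = proj₂ (local uv) full , escapes≡0
    where
    w = weight G u v
    w≡192 : w ≡ 192
    w≡192 = trans eq (cong (16 *_) (others≡12 uv))
    total : w + #escapes G u v ≡ localWeight (p u v) (q u v) (t u v) (s u v)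
    total = weight+escapes G u v
    full : localWeight (p u v) (q u v) (t u v) (s u v) ≡ 192
    full = ℕ.≤-antisym (proj₁ (local uv)) (subst (_≤ localWeight (p u v) (q u v) (t u v) (s u v)) w≡192 (weight≤ G u v))
    escapes≡0 : #escapes G u v ≡ 0
    escapes≡0 = ℕ.+-cancelˡ-≡ w _ 0 (trans total (trans full (trans (sym w≡192) (sym (ℕ.+-identityʳ w)))))

  -- Both orders of the sizes are evaluated because `u` may lie on either side.
  Kpq-tight : ∀ {p₀ q₀} → (∀ s → p₀ + q₀ + s ≡ 12 → localWeight p₀ q₀ 0 s ≡ 192 × localWeight q₀ p₀ 0 s ≡ 192) →
    ComplementIsKpq G (suc p₀) (suc q₀) → ∀ {u v} → r u v ≡ non → weight G u v ≡ 16 * others G u v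
  Kpq-tight {p₀} {q₀} value Kpq {u} {v} uv = trans (Kpq-weight G Kpq uv)
    (trans (on (Kpq-private G Kpq uv)) (cong (16 *_) (sym (others≡12 uv))))
    where
    sum≡12 : p u v + q u v + s u v ≡ 12
    sum≡12 = trans (sym (Kpq-others G Kpq uv)) (others≡12 uv)
    on : (suc (p u v) ≡ suc q₀ × suc (q u v) ≡ suc p₀) ⊎ (suc (p u v) ≡ suc p₀ × suc (q u v) ≡ suc q₀) →
      localWeight (p u v) (q u v) 0 (s u v) ≡ 192
    on (inj₁ (eq₁ , eq₂)) = trans
      (cong₂ (λ x y → localWeight x y 0 (s u v)) (ℕ.suc-injective eq₁) (ℕ.suc-injective eq₂))
      (proj₂ (value (s u v) (trans (cong (_+ s u v) (trans (ℕ.+-comm p₀ q₀)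
        (sym (cong₂ _+_ (ℕ.suc-injective eq₁) (ℕ.suc-injective eq₂))))) sum≡12)))
    on (inj₂ (eq₁ , eq₂)) = trans
      (cong₂ (λ x y → localWeight x y 0 (s u v)) (ℕ.suc-injective eq₁) (ℕ.suc-injective eq₂))
      (proj₁ (value (s u v) (trans (cong (_+ s u v)
        (sym (cong₂ _+_ (ℕ.suc-injective eq₁) (ℕ.suc-injective eq₂)))) sum≡12)))

  K₄₅⊎K₅₅-tight : ComplementIsKpq G 4 5 ⊎ ComplementIsKpq G 5 5 →
    ∀ {u v} → r u v ≡ non → weight G u v ≡ 16 * others G u v
  K₄₅⊎K₅₅-tight (inj₁ K₄₅) = Kpq-tight value K₄₅
    where
    value : ∀ s → 7 + s ≡ 12 → localWeight 3 4 0 s ≡ 192 × localWeight 4 3 0 s ≡ 192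
    value _ refl = refl , refl
  K₄₅⊎K₅₅-tight (inj₂ K₅₅) = Kpq-tight value K₅₅
    where
    value : ∀ s → 8 + s ≡ 12 → localWeight 4 4 0 s ≡ 192 × localWeight 4 4 0 s ≡ 192
    value _ refl = refl , refl

-- Fifteen or more vertices

module _ {d} (G : Graph d) (K₅₅ : ComplementIsKpq G 5 5) where

  -- For p = q = 4 and t = 0 the weight is 64 + 32s, to be compared with 16 (8 + s) = 128 + 16s. It
  -- is larger as soon as s ≥ 5, and s = d - 10.
  K₅₅-heavy : 15 ≤ d → ∀ {u v} → rel G u v ≡ non → 16 * others G u v < weight G u v
  K₅₅-heavy 15≤d {u} {v} uv = subst₂ (λ x y → 16 * x < y)
    (sym (trans (Kpq-others G K₅₅ uv) (cong₂ (λ x y → x + y + s) p≡4 q≡4)))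
    (sym (trans (Kpq-weight G K₅₅ uv) (cong₂ (λ x y → localWeight x y 0 s) p≡4 q≡4)))
    (subst₂ _<_ (left s) (right s) (ℕ.+-monoʳ-< (64 + 16 * s) (ℕ.<-≤-trans 64<80 (ℕ.*-monoʳ-≤ 16 5≤s))))
    where
    s = #nonadjacent G u v
    fours : #private₁ G u v ≡ 4 × #private₂ G u v ≡ 4
    fours with Kpq-private G K₅₅ uv
    ... | inj₁ (x , y) = ℕ.suc-injective x , ℕ.suc-injective y
    ... | inj₂ (x , y) = ℕ.suc-injective x , ℕ.suc-injective y
    p≡4 : #private₁ G u v ≡ 4
    p≡4 = proj₁ fours
    q≡4 : #private₂ G u v ≡ 4
    q≡4 = proj₂ fours
    size : 8 + s + 2 ≡ d
    size = trans (cong (_+ 2) (sym (trans (Kpq-others G K₅₅ uv) (cong₂ (λ x y → x + y + s) p≡4 q≡4))))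
      (others+2 G (non-≢ G uv))
    5≤s : 5 ≤ s
    5≤s = ℕ.+-cancelˡ-≤ 8 5 s (ℕ.+-cancelʳ-≤ 2 13 (8 + s) (subst (15 ≤_) (sym size) 15≤d))
    64<80 : 64 < 80
    64<80 = ℕ.m≤m+n 65 15
    left : ∀ s → (64 + 16 * s) + 64 ≡ 16 * (8 + s)
    left = solve-∀
    right : ∀ s → (64 + 16 * s) + 16 * s ≡ 4 * 8 + 8 * 0 + 2 * 16 + 4 * (8 * s)
    right = solve-∀

-- Removing a complete bipartite graph from the complete graph

module _ {d} (A B : Subset d) where

  private
    Joined : Fin d → Fin d → Set
    Joined i j = (i ∈ A × j ∈ B) ⊎ (i ∈ B × j ∈ A)

    joined? : ∀ i j → Dec (Joined i j)
    joined? i j = ((i ∈? A) ×-dec (j ∈? B)) ⊎-dec ((i ∈? B) ×-dec (j ∈? A))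

    edge? : ∀ i j → Dec (i ≢ j × ¬ Joined i j)
    edge? i j = ¬? (i ≟ j) ×-dec ¬? (joined? i j)

    flip : ∀ {i j} → Joined i j → Joined j i
    flip (inj₁ (x , y)) = inj₂ (y , x)
    flip (inj₂ (x , y)) = inj₁ (y , x)

    flip-edge : ∀ {i j} → i ≢ j × ¬ Joined i j → j ≢ i × ¬ Joined j i
    flip-edge (i≢j , ¬J) = i≢j ∘ sym , ¬J ∘ flip

  complete-minus : Graph d
  complete-minus = record
    { adj = λ i j → ⌊ edge? i j ⌋
    ; adjSym = symmetric
    ; irrefl = irreflexive
    }
    where
    symmetric : ∀ i j → ⌊ edge? i j ⌋ ≡ ⌊ edge? j i ⌋
    symmetric i j with edge? i j | edge? j i
    ... | yes _ | yes _ = refl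
    ... | no _  | no _  = refl
    ... | yes p | no ¬p = ⊥-elim (¬p (flip-edge p))
    ... | no ¬p | yes p = ⊥-elim (¬p (flip-edge p))
    irreflexive : ∀ i → ⌊ edge? i i ⌋ ≡ false
    irreflexive i with edge? i i
    ... | yes (i≢i , _) = ⊥-elim (i≢i refl)
    ... | no _ = refl

  complete-minus-Kpq : (∀ i → i ∈ A → i ∉ B) → ComplementIsKpq complete-minus ∣ A ∣ ∣ B ∣
  complete-minus-Kpq disjoint = A , B , refl , refl , disjoint , λ i j i≢j → to i j i≢j , from i j
    where
    to : ∀ i j → i ≢ j → ⌊ edge? i j ⌋ ≡ false → Joined i j
    to i j i≢j eq with joined? i j | edge? i j
    ... | yes J | _ = J
    ... | no ¬J | no ¬p = ⊥-elim (¬p (i≢j , ¬J))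
    from : ∀ i j → Joined i j → ⌊ edge? i j ⌋ ≡ false
    from i j J with edge? i j
    ... | yes (_ , ¬J) = ⊥-elim (¬J J)
    ... | no _ = refl

first-five second-five : ∀ e → Subset (10 + e)
first-five e  = true ∷ true ∷ true ∷ true ∷ true ∷ false ∷ false ∷ false ∷ false ∷ false ∷ Subset.⊥
second-five e = false ∷ false ∷ false ∷ false ∷ false ∷ true ∷ true ∷ true ∷ true ∷ true ∷ Subset.⊥

fives-disjoint : ∀ e i → i ∈ first-five e → i ∉ second-five e
fives-disjoint e i i∈ i∈′ = on i ([]=⇒lookup i∈) ([]=⇒lookup i∈′)
  where
  on : ∀ i → lookup (first-five e) i ≡ true → lookup (second-five e) i ≡ true → ⊥
  on (suc (suc (suc (suc (suc zero))))) () _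
  on (suc (suc (suc (suc (suc (suc zero)))))) () _
  on (suc (suc (suc (suc (suc (suc (suc zero))))))) () _
  on (suc (suc (suc (suc (suc (suc (suc (suc zero)))))))) () _
  on (suc (suc (suc (suc (suc (suc (suc (suc (suc zero))))))))) () _
  on (suc (suc (suc (suc (suc (suc (suc (suc (suc (suc i)))))))))) eq _ =
    ∉⊥ (lookup⇒[]= i Subset.⊥ eq)

K-minus-K₅₅ : ∀ e → Graph (10 + e)
K-minus-K₅₅ e = complete-minus (first-five e) (second-five e)

K-minus-K₅₅-complement : ∀ e → ComplementIsKpq (K-minus-K₅₅ e) 5 5
K-minus-K₅₅-complement e = subst₂ (ComplementIsKpq (K-minus-K₅₅ e))
  (cong (5 +_) (∣⊥∣≡0 e)) (cong (5 +_) (∣⊥∣≡0 e))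
  (complete-minus-Kpq (first-five e) (second-five e) (fives-disjoint e))

K-minus-K₅₅-incomplete : ∀ e → ¬ IsComplete (K-minus-K₅₅ e)
K-minus-K₅₅-incomplete e complete with () ← complete zero (suc (suc (suc (suc (suc zero))))) (λ ())

K-minus-K₅₅-more-edges : ∀ d → 15 ≤ d →
  Σ (Graph d) λ G → Σ ℕ λ n → Σ ℕ λ m → NumPolytopeEdges G n × NumPolytopeEdges (K d) m × (m < n)
K-minus-K₅₅-more-edges d 15≤d with e , refl ← ℕ.m≤n⇒∃[o]m+o≡n (ℕ.≤-trans (ℕ.m≤m+n 10 5) 15≤d) =
  G , _ , _ , numPolytopeEdges-exists G , numPolytopeEdges-exists (K (10 + e)) ,
  more-edges G (K-minus-K₅₅-incomplete e) (K₅₅-heavy G (K-minus-K₅₅-complement e) 15≤d)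
  where
  G = K-minus-K₅₅ e

theorem0p1 : (∀ (d : ℕ) → 3 ≤ d → d ≤ 13 → (G : Graph d) → ¬ IsComplete G →
    ∀ n m → NumPolytopeEdges G n → NumPolytopeEdges (K d) m → n < m)
    ×
    (∀ (G : Graph 14) → ¬ IsComplete G →
    ∀ n m → NumPolytopeEdges G n → NumPolytopeEdges (K 14) m →
    (n ≤ m) ×
    (n ≡ m → ComplementIsKpq G 4 5 ⊎ ComplementIsKpq G 5 5) ×
    (ComplementIsKpq G 4 5 ⊎ ComplementIsKpq G 5 5 → n ≡ m))
    ×
    (∀ (d : ℕ) → 15 ≤ d →
    Σ (Graph d) λ G → Σ ℕ λ n → Σ ℕ λ m →
    NumPolytopeEdges G n × NumPolytopeEdges (K d) m × (m < n))
theorem0p1 = small , fourteen , K-minus-K₅₅-more-edges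
  where
  small : ∀ d → 3 ≤ d → d ≤ 13 → (G : Graph d) → ¬ IsComplete G →
    ∀ n m → NumPolytopeEdges G n → NumPolytopeEdges (K d) m → n < m
  small d 3≤d d≤13 G ¬complete n m #n #m =
    subst₂ _<_ (sym (numPolytopeEdges-unique G #n)) (sym (numPolytopeEdges-unique (K d) #m))
      (fewer-edges G ¬complete (light-small G 3≤d d≤13))
  fourteen : (G : Graph 14) → ¬ IsComplete G →
    ∀ n m → NumPolytopeEdges G n → NumPolytopeEdges (K 14) m →
    (n ≤ m) ×
    (n ≡ m → ComplementIsKpq G 4 5 ⊎ ComplementIsKpq G 5 5) ×
    (ComplementIsKpq G 4 5 ⊎ ComplementIsKpq G 5 5 → n ≡ m)
  fourteen G ¬complete n m #n #m =
    subst₂ _≤_ (sym n≡) (sym m≡) (at-most-as-many-edges G (weight₁₄ G)) ,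
    (λ n≡m → tight⇒K₄₅⊎K₅₅ G
      (λ uv → tight₁₄ G uv (equality-tight G (weight₁₄ G) (trans (sym n≡) (trans n≡m m≡)) uv)) ¬complete) ,
    (λ Kpq → trans n≡ (trans (equally-many-edges G (K₄₅⊎K₅₅-tight G Kpq)) (sym m≡)))
    where
    n≡ = numPolytopeEdges-unique G #n
    m≡ = numPolytopeEdges-unique (K 14) #m
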